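{- A locally geometric poset $\mathcal{P}$ of rank $r$ is divisional if and only if there exists a chain $\hat0=x_0<x_1<\cdots<x_r$ in $\mathcal{P}$ with $\operatorname{rk}(x_i)=i$ such that, setting $\mathcal{Q}_i:=\mathcal{P}_{\ge x_i}$, the polynomial $\chi_{\mathcal{Q}_i}(t)$ divides $\chi_{\mathcal{Q}_{i-1}}(t)$ for each $1\le i\le r$. In this case $\mathcal{P}$ is factorable with $\exp(\mathcal{P})=\{d_1,\dots,d_r\}$, where $d_i:=|A(\mathcal{Q}_{i-1})|-|A(\mathcal{Q}_i)|$.
   Context: All posets are finite, have a unique minimal element $\hat0$ and are ranked; $\operatorname{rk}(\mathcal{P})=\max\operatorname{rk}$; $\chi_{\mathcal{P}}(t)=\sum_x\mu(\hat0,x)t^{\operatorname{rk}(\mathcal{P})-\operatorname{rk}(x)}$. For $x\in\mathcal{P}$, $\mathcal{P}_{\ge x}=\{y:y\ge x\}$ is a poset with minimal element $x$ and rank function $\operatorname{rk}-\operatorname{rk}(x)$; $A(\mathcal{Q})$ denotes the set of atoms (elements of rank 1) of a poset $\mathcal{Q}$. $\mathcal{P}$ is factorable if every root of $\chi_{\mathcal{P}}$ is a positive integer, and $\exp(\mathcal{P})$ is the multiset of roots. $x\vee y$ is the set of minimal upper bounds. A lattice is geometric if $y$ covers $x$ iff there is an atom $a\not\le x$ with $y=x\vee a$; $\mathcal{P}$ is locally geometric if each $\mathcal{P}_{\le x}$ is a geometric lattice. Divisional posets: smallest class of locally geometric posets containing $\{\hat0\}$ and containing $\mathcal{P}$ whenever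 some atom $a$ has $\mathcal{P}_{\ge a}$ divisional and $\chi_{\mathcal{P}_{\ge a}}\mid\chi_{\mathcal{P}}$.
   Formalization: "Ranked" is taken to include purity (all maximal elements have equal rank); without it the claim fails: for 0̂<a,b,c and b,c<u, the poset is divisional via a, but χ = t²−3t+1 has no integer roots and no required chain exists. -}

module Defs where

open import Level using (0ℓ)
open import Algebra.Bundles using (CommutativeRing)
open import Algebra.Bundles.Raw using (RawMagma)
import Algebra.Definitions.RawMagma as MagmaDivisibility
import Algebra.Definitions.RawMonoid as MonoidMultiples
open import Data.Bool.Base using (if_then_else_)
open import Data.Empty using (⊥-elim)
open import Data.Fin.Base using (Fin; toℕ; inject₁)
  renaming (zero to fzero; suc to fsuc)
open import Data.Integer.Base as ℤ using (ℤ; +_; -[1+_]; 0ℤ; 1ℤ)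
open import Data.List.Base using (List; []; _∷_; [_]; _++_; map; foldr; filter; length; replicate)
open import Data.List.Extrema.Nat using (max)
import Data.List.Membership.Setoid as Membership
open import Data.List.Relation.Unary.All using (All; []; _∷_)
open import Data.List.Relation.Unary.AllPairs using ([]; _∷_)
open import Data.List.Relation.Unary.Any as Any using (any?; satisfied; here; there)
open import Data.List.Relation.Unary.Enumerates.Setoid using (IsEnumeration)
open import Data.List.Relation.Unary.Unique.Setoid using (Unique)
open import Data.Nat.Base as ℕ using (ℕ; zero; suc; _∸_)
open import Data.Nat.Properties as ℕₚ using ()
open import Data.Nat.Induction using (<-wellFounded)
open import Data.Product.Base using (Σ; ∃-syntax; _×_; _,_; proj₁; proj₂)
open import Data.Sum.Base using (_⊎_)
open import Function.Base using (_∘_)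
open import Function.Bundles using (_⇔_)
open import Induction.WellFounded using (Acc; acc)
open import Relation.Binary.Bundles using (DecPoset; Setoid)
open import Relation.Binary.Core using (Rel)
import Relation.Binary.Construct.On as On
import Relation.Binary.Construct.NonStrictToStrict as ToStrict
import Relation.Binary.Properties.Poset as PosetProperties
open import Relation.Binary.Definitions using (Decidable)
open import Relation.Binary.Lattice.Structures using (IsLattice)
open import Relation.Binary.PropositionalEquality using (_≡_; trans; cong)
open import Relation.Nullary using (¬_; yes; no; does)
open import Relation.Nullary.Decidable using (_×-dec_)
import Relation.Unary as U

------------------------------------------------------------------------
-- ℤ[t]

-- Coefficients from low to high degree.  Trailing zeros are allowed, so
-- equality of polynomials is _≈ₚ_ and not _≡_.
Poly : Set
Poly = List ℤ

coeff : Poly → ℕ → ℤ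
coeff []      _       = 0ℤ
coeff (c ∷ p) zero    = c
coeff (c ∷ p) (suc n) = coeff p n

infix 4 _≈ₚ_

_≈ₚ_ : Rel Poly 0ℓ
p ≈ₚ q = ∀ n → coeff p n ≡ coeff q n

infixl 6 _+ₚ_
infixl 7 _*ₚ_ _·ₚ_

_+ₚ_ : Poly → Poly → Poly
[]      +ₚ q       = q
(c ∷ p) +ₚ []      = c ∷ p
(c ∷ p) +ₚ (d ∷ q) = (c ℤ.+ d) ∷ (p +ₚ q)

_·ₚ_ : ℤ → Poly → Poly
c ·ₚ p = map (c ℤ.*_) p

_*ₚ_ : Poly → Poly → Poly
[]      *ₚ q = []
(c ∷ p) *ₚ q = c ·ₚ q +ₚ (0ℤ ∷ p *ₚ q)

monomial : ℤ → ℕ → Poly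
monomial c n = replicate n 0ℤ ++ [ c ]

*ₚ-rawMagma : RawMagma 0ℓ 0ℓ
*ₚ-rawMagma = record { Carrier = Poly ; _≈_ = _≈ₚ_ ; _∙_ = _*ₚ_ }

open MagmaDivisibility *ₚ-rawMagma public using () renaming (_∣_ to _∣ₚ_)

t-_ : ℤ → Poly
t- d = (ℤ.- d) ∷ 1ℤ ∷ []

-- The list ds is the multiset of all roots of p, with multiplicity
-- (order is irrelevant because only the product of the t - d is used).
HasRootMultiset : Poly → List ℤ → Set
HasRootMultiset p ds =
  ∃[ c ] ¬ c ≡ 0ℤ × p ≈ₚ c ·ₚ foldr (λ d q → (t- d) *ₚ q) [ 1ℤ ] ds

------------------------------------------------------------------------
-- Roots in extensions of ℤ

record IsCharZeroDomain (K : CommutativeRing 0ℓ 0ℓ) : Set where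
  open CommutativeRing K using (Carrier; _≈_; 0#; 1#; _*_; +-rawMonoid)
  open MonoidMultiples +-rawMonoid using () renaming (_×_ to _times_)
  field
    noZeroDivisors : ∀ (x y : Carrier) → x * y ≈ 0# → x ≈ 0# ⊎ y ≈ 0#
    charZero       : ∀ n → ¬ (suc n times 1#) ≈ 0#

module _ (K : CommutativeRing 0ℓ 0ℓ) where
  private module K = CommutativeRing K
  open MonoidMultiples K.+-rawMonoid using () renaming (_×_ to _times_)

  fromℤ : ℤ → K.Carrier
  fromℤ (+ n)    = n times K.1#
  fromℤ -[1+ n ] = K.- (suc n times K.1#)

  eval : Poly → K.Carrier → K.Carrier
  eval []      x = K.0#
  eval (c ∷ p) x = fromℤ c K.+ x K.* eval p x

-- The complex numbers are not available; their role as the place where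
-- roots live is taken by all integral domains of characteristic zero.
AllRootsPositiveIntegers : Poly → Set₁
AllRootsPositiveIntegers p =
  ∀ (K : CommutativeRing 0ℓ 0ℓ) → IsCharZeroDomain K →
  let open CommutativeRing K using (Carrier; _≈_; 0#) in
  ∀ (x : Carrier) → eval K p x ≈ 0# → ∃[ n ] x ≈ fromℤ K (+ suc n)

------------------------------------------------------------------------
-- Covers, minimal and maximal elements

module Order (D : DecPoset 0ℓ 0ℓ 0ℓ) where
  open DecPoset D
  open PosetProperties poset public using (_<_)

  _<?_ : Decidable _<_
  _<?_ = ToStrict.<-decidable _≈_ _≤_ _≟_ _≤?_

  infix 4 _⋖_

  -- y covers x
  _⋖_ : Rel Carrier 0ℓ
  x ⋖ y = x < y × (∀ z → ¬ (x < z × z < y))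

  Minimal : Carrier → Set
  Minimal x = ∀ y → y ≤ x → y ≈ x

  Maximal : Carrier → Set
  Maximal x = ∀ y → x ≤ y → y ≈ x

------------------------------------------------------------------------
-- Finite ranked posets with a unique minimal element

-- "Ranked" means that all maximal chains have the same length: there is a
-- rank function, and all maximal elements have the same rank.  Purity is
-- needed: if 0̂ < a, b, c and b, c < u are the only strict relations besides
-- 0̂ < u, then χ of the elements above a is 1, which divides every
-- polynomial, but χ of the whole poset is t² - 3t + 1, without integer roots.
record RankedPoset : Set₁ where
  field
    decPoset : DecPoset 0ℓ 0ℓ 0ℓ

  open DecPoset decPoset public
    using (Carrier; _≈_; _≤_; _≟_; _≤?_; module Eq; antisym; reflexive)
    renaming (refl to ≤-refl; trans to ≤-trans)
  open Order decPoset public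

  field
    elements     : List Carrier
    enumerates   : IsEnumeration Eq.setoid elements
    unique       : Unique Eq.setoid elements
    0̂            : Carrier
    0̂-minimal    : Minimal 0̂
    0̂-unique     : ∀ x → Minimal x → x ≈ 0̂
    rk           : Carrier → ℕ
    rk-cong      : ∀ {x y} → x ≈ y → rk x ≡ rk y
    rk-0̂         : rk 0̂ ≡ 0
    rk-mono-<    : ∀ {x y} → x < y → rk x ℕ.< rk y
    rk-cover     : ∀ {x y} → x ⋖ y → rk y ≡ suc (rk x)
    rk-maximal   : ∀ {x y} → Maximal x → Maximal y → rk x ≡ rk y

  rk-mono-≤ : ∀ {x y} → x ≤ y → rk x ℕ.≤ rk y
  rk-mono-≤ {x} {y} x≤y with x ≟ y
  ... | yes x≈y = ℕₚ.≤-reflexive (rk-cong x≈y)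
  ... | no  x≉y = ℕₚ.<⇒≤ (rk-mono-< (x≤y , x≉y))

  0̂-minimum : ∀ x → 0̂ ≤ x
  0̂-minimum x = go x (<-wellFounded (rk x))
    where
    go : ∀ x → Acc ℕ._<_ (rk x) → 0̂ ≤ x
    go x (acc rec) with any? (_<? x) elements
    ... | yes below = let (y , y<x) = satisfied below in
                      ≤-trans (go y (rec (rk-mono-< y<x))) (proj₁ y<x)
    ... | no  none  = reflexive (Eq.sym (0̂-unique x minimal))
      where
      minimal : Minimal x
      minimal y y≤x with y ≟ x
      ... | yes y≈x = y≈x
      ... | no  y≉x = ⊥-elim (none (Any.map (λ y≈z →
        ≤-trans (reflexive (Eq.sym y≈z)) y≤x , λ z≈x → y≉x (Eq.trans y≈z z≈x)) (enumerates y)))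

------------------------------------------------------------------------
-- The subposets P≥x and P≤x

module _ {A : Set} {S : A → Set} (S? : U.Decidable S) where

  restrict : List A → List (Σ A S)
  restrict []       = []
  restrict (x ∷ xs) with S? x
  ... | yes s = (x , s) ∷ restrict xs
  ... | no  _ = restrict xs

module Sub (P : RankedPoset) {S : RankedPoset.Carrier P → Set} (S? : U.Decidable S)
           (S-resp : ∀ {x y} → RankedPoset._≈_ P x y → S x → S y) where
  open RankedPoset P

  subDecPoset : DecPoset 0ℓ 0ℓ 0ℓ
  subDecPoset = On.decPoset decPoset (proj₁ {B = S})

  private
    subSetoid : Setoid 0ℓ 0ℓ
    subSetoid = DecPoset.Eq.setoid subDecPoset

    open Membership Eq.setoid using (_∈_)
    open Membership subSetoid using () renaming (_∈_ to _∈ₛ_)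

    restrict-∈ : ∀ {xs} y → proj₁ y ∈ xs → y ∈ₛ restrict S? xs
    restrict-∈ {x ∷ xs} y y∈ with S? x | y∈
    ... | yes _ | here y≈x = here y≈x
    ... | yes _ | there p  = there (restrict-∈ y p)
    ... | no ¬s | here y≈x = ⊥-elim (¬s (S-resp y≈x (proj₂ y)))
    ... | no _  | there p  = restrict-∈ y p

    restrict-All : ∀ {Q : Carrier → Set} {xs} → All Q xs → All (Q ∘ proj₁) (restrict S? xs)
    restrict-All []                = []
    restrict-All {xs = x ∷ _} (q ∷ qs) with S? x
    ... | yes _ = q ∷ restrict-All qs
    ... | no  _ = restrict-All qs

    restrict-Unique : ∀ {xs} → Unique Eq.setoid xs → Unique subSetoid (restrict S? xs)
    restrict-Unique []                = []
    restrict-Unique {x ∷ _} (q ∷ qs) with S? x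
    ... | yes _ = restrict-All q ∷ restrict-Unique qs
    ... | no  _ = restrict-Unique qs

  subElements : List (Σ Carrier S)
  subElements = restrict S? elements

  subEnumerates : IsEnumeration subSetoid subElements
  subEnumerates y = restrict-∈ y (enumerates (proj₁ y))

  subUnique : Unique subSetoid subElements
  subUnique = restrict-Unique unique

  module _ (convex : ∀ {x y z} → S x → S z → x ≤ y → y ≤ z → S y) where
    sub-⋖ : ∀ {x y : Σ Carrier S} → Order._⋖_ subDecPoset x y → proj₁ x ⋖ proj₁ y
    sub-⋖ {x , sx} {y , sy} (x<y , none) =
      x<y , λ z (x<z , z<y) → none (z , convex sx sy (proj₁ x<z) (proj₁ z<y)) (x<z , z<y)

module _ (P : RankedPoset) (x : RankedPoset.Carrier P) where
  open RankedPoset P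

  private
    module Up   = Sub P {x ≤_} (x ≤?_) (λ y≈z x≤y → ≤-trans x≤y (reflexive y≈z))
    module Down = Sub P {_≤ x} (_≤? x) (λ y≈z y≤x → ≤-trans (reflexive (Eq.sym y≈z)) y≤x)

  upper : RankedPoset
  upper = record
    { decPoset   = Up.subDecPoset
    ; elements   = Up.subElements
    ; enumerates = Up.subEnumerates
    ; unique     = Up.subUnique
    ; 0̂          = x , ≤-refl
    ; 0̂-minimal  = λ (y , x≤y) y≤x → antisym y≤x x≤y
    ; 0̂-unique   = λ (y , x≤y) min → Eq.sym (min (x , ≤-refl) x≤y)
    ; rk         = λ (y , _) → rk y ∸ rk x
    ; rk-cong    = λ y≈z → cong (_∸ rk x) (rk-cong y≈z)
    ; rk-0̂       = ℕₚ.n∸n≡0 (rk x)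
    ; rk-mono-<  = λ {y} y<z → ℕₚ.∸-monoˡ-< (rk-mono-< y<z) (rk-mono-≤ (proj₂ y))
    ; rk-cover   = λ {y} {z} y⋖z →
        trans (cong (_∸ rk x) (rk-cover (Up.sub-⋖ (λ x≤u _ u≤v _ → ≤-trans x≤u u≤v) {y} {z} y⋖z)))
              (ℕₚ.+-∸-assoc 1 (rk-mono-≤ (proj₂ y)))
    ; rk-maximal = λ {y} {z} my mz → cong (_∸ rk x) (rk-maximal (maximal y my) (maximal z mz))
    }
    where
    maximal : ∀ y → Order.Maximal Up.subDecPoset y → Maximal (proj₁ y)
    maximal (y , x≤y) my z y≤z = my (z , ≤-trans x≤y y≤z) y≤z

  lower : RankedPoset
  lower = record
    { decPoset   = Down.subDecPoset
    ; elements   = Down.subElements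
    ; enumerates = Down.subEnumerates
    ; unique     = Down.subUnique
    ; 0̂          = 0̂ , 0̂-minimum x
    ; 0̂-minimal  = λ (y , _) y≤0̂ → 0̂-minimal y y≤0̂
    ; 0̂-unique   = λ (y , _) min → Eq.sym (min (0̂ , 0̂-minimum x) (0̂-minimum y))
    ; rk         = λ (y , _) → rk y
    ; rk-cong    = rk-cong
    ; rk-0̂       = rk-0̂
    ; rk-mono-<  = rk-mono-<
    ; rk-cover   = λ {y} {z} y⋖z →
        rk-cover (Down.sub-⋖ (λ _ v≤x _ u≤v → ≤-trans u≤v v≤x) {y} {z} y⋖z)
    ; rk-maximal = λ {y} {z} my mz →
        trans (rk-cong (Eq.sym (my (x , ≤-refl) (proj₂ y)))) (rk-cong (mz (x , ≤-refl) (proj₂ z)))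
    }

------------------------------------------------------------------------
-- Invariants of a ranked poset

module _ (P : RankedPoset) where
  open RankedPoset P

  rank : ℕ
  rank = max 0 (map rk elements)

  Atom : Carrier → Set
  Atom a = rk a ≡ 1

  atoms : List Carrier
  atoms = filter (λ a → rk a ℕₚ.≟ 1) elements

  -- μ(x,x) = 1 and μ(x,y) = - Σ_{x ≤ z < y} μ(x,z) for x ≠ y (an empty sum
  -- if x ≰ y).  The first argument bounds the recursion depth; rk y is
  -- enough because rk decreases strictly from y to z.
  μ-fuel : ℕ → Carrier → Carrier → ℤ
  μ-fuel zero    x y = if does (x ≟ y) then 1ℤ else 0ℤ
  μ-fuel (suc n) x y =
    if does (x ≟ y) then 1ℤ
    else ℤ.- foldr ℤ._+_ 0ℤ
               (map (μ-fuel n x) (filter (λ z → (x ≤? z) ×-dec (z <? y)) elements))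

  μ : Carrier → Carrier → ℤ
  μ x y = μ-fuel (rk y) x y

  χ : Poly
  χ = foldr _+ₚ_ [] (map (λ x → monomial (μ 0̂ x) (rank ∸ rk x)) elements)

  Factorable : Set₁
  Factorable = AllRootsPositiveIntegers χ

  -- exp(P) is the multiset ds
  HasExponents : List ℤ → Set
  HasExponents ds = HasRootMultiset χ ds

  record IsGeometricLattice : Set where
    field
      _∨_       : Carrier → Carrier → Carrier
      _∧_       : Carrier → Carrier → Carrier
      isLattice : IsLattice _≈_ _≤_ _∨_ _∧_
      geometric : ∀ x y → x ⋖ y ⇔ (∃[ a ] Atom a × ¬ a ≤ x × y ≈ x ∨ a)

LocallyGeometric : RankedPoset → Set
LocallyGeometric P = ∀ x → IsGeometricLattice (lower P x)

------------------------------------------------------------------------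
-- Divisional posets

data Divisional : RankedPoset → Set₁ where
  -- {0̂}, up to isomorphism
  point : ∀ P → (∀ x → RankedPoset._≈_ P x (RankedPoset.0̂ P)) → Divisional P
  step  : ∀ P → LocallyGeometric P →
          ∀ a → Atom P a → Divisional (upper P a) → χ (upper P a) ∣ₚ χ P →
          Divisional P

module _ (P : RankedPoset) where
  open RankedPoset P

  record IsDivisionalChain {r : ℕ} (x : Fin (suc r) → Carrier) : Set where
    field
      starts     : x fzero ≈ 0̂
      increasing : ∀ (i : Fin r) → x (inject₁ i) < x (fsuc i)
      ranks      : ∀ (i : Fin (suc r)) → rk (x i) ≡ toℕ i
      divides    : ∀ (i : Fin r) → χ (upper P (x (fsuc i))) ∣ₚ χ (upper P (x (inject₁ i)))

  -- d x i is |A(Q_i)| - |A(Q_{i+1})|, the index being shifted down by one.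
  d : {r : ℕ} → (Fin (suc r) → Carrier) → Fin r → ℤ
  d x i = + length (atoms (upper P (x (inject₁ i)))) ℤ.- + length (atoms (upper P (x (fsuc i))))

{-# OPTIONS --safe #-}

-- Divisibility of characteristic polynomials only depends on the posets up to
-- isomorphism, and (P≥a)≥y is P≥y, so unfolding the inductive definition of
-- divisional posets gives a chain; conversely a chain below its second element
-- a is a chain of P≥a, which is again locally geometric.  Purity gives
-- rk P≥x = rk P - rk x, so χ is monic of degree one more for Q_{i-1} than for
-- Q_i, and χ(Q_{i-1}) = (t - d) χ(Q_i); as the subleading coefficient of χ is
-- minus the number of atoms, d = d_i.  In a geometric lattice Weisner's theorem
-- gives μ(0̂,x) the sign (-1)^rk(x), so by purity the constant coefficient of χ
-- has the sign (-1)^rank, and comparing constant coefficients gives d_i > 0.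

module Submission where

open import Defs
open import Algebra.Bundles using (CommutativeRing; CommutativeMonoid)
open import Algebra.Definitions.RawMagma using (_,_)
import Algebra.Properties.CommutativeSemigroup as CommutativeSemigroupProperties
import Algebra.Properties.Monoid.Mult as MultProperties
import Algebra.Properties.Ring as RingProperties
open import Data.Bool.Base using (true; false; if_then_else_)
open import Data.Fin.Base using (Fin; toℕ; inject₁) renaming (zero to fzero; suc to fsuc)
import Data.Fin.Properties as Finₚ
open import Data.Integer.Base as ℤ using (ℤ; +_; -[1+_]; 0ℤ; 1ℤ; -1ℤ)
import Data.Integer.Properties as ℤₚ
open import Data.Integer.Tactic.RingSolver using (solve-∀)
open import Data.List.Base using (List; []; _∷_; [_]; map; foldr; filter; length; tabulate)
open import Data.List.Extrema.Nat using (max≤v⁺; v≤max⁺)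
import Data.List.Membership.Setoid as Membership
open import Data.List.Relation.Unary.All as All using (All; []; _∷_)
import Data.List.Relation.Unary.All.Properties as Allₚ
open import Data.List.Relation.Unary.AllPairs using ([]; _∷_)
open import Data.List.Relation.Unary.Any as Any using (any?; satisfied; here; there)
import Data.List.Relation.Unary.Any.Properties as Anyₚ
open import Data.List.Relation.Unary.Enumerates.Setoid using (IsEnumeration)
open import Data.List.Relation.Unary.Unique.Setoid using (Unique)
open import Data.Nat.Base as ℕ using (ℕ; zero; suc; _∸_)
open import Data.Nat.Induction using (<-wellFounded)
import Data.Nat.Properties as ℕₚ
open import Data.Product.Base using (∃-syntax; _×_; _,_; proj₁; proj₂)
open import Data.Sum.Base using (_⊎_; inj₁; inj₂)
open import Function.Base using (_∘_; id)
open import Function.Bundles using (Equivalence; mk⇔; _⇔_)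
open import Induction.WellFounded using (Acc; acc)
open import Level using (0ℓ)
open import Relation.Binary.Bundles using (DecPoset; DecSetoid; StrictPartialOrder)
open import Relation.Binary.Lattice.Structures using (IsLattice)
import Relation.Binary.Properties.Poset as PosetProperties
open import Relation.Binary.PropositionalEquality
  using (_≡_; refl; sym; trans; cong; cong₂; subst; subst₂; module ≡-Reasoning)
import Relation.Binary.Reasoning.Setoid as SetoidReasoning
open import Relation.Nullary using (¬_; Dec; yes; no; does; contradiction)
open import Relation.Nullary.Decidable using (_×-dec_; decidable-stable)
import Relation.Unary as U

-- Finite sums of integers

-- Equality of elements is a setoid equality and elements of subposets carry proofs, so posets that
-- agree on paper, such as `upper (upper P x) y` and `upper P (proj₁ y)`, are only isomorphic. Every
-- sum therefore runs over a full enumeration, with side conditions turned into zero terms by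
-- `when`; two sums are compared by inserting a Kronecker delta and exchanging a double sum.
-- Weisner's theorem is obtained by the same device. The sign argument is needed for every P≥x in
-- the chain, so local geometricity must pass to P≥x for arbitrary x. This rests on writing the
-- atoms of an interval [a, y] as a ∨ c with c an atom of [0̂, y] that is not below a.

when : ∀ {ℓ} {A : Set ℓ} → Dec A → ℤ → ℤ
when A? z = if does A? then z else 0ℤ

module _ {ℓ} {A : Set ℓ} where

  when-yes : (A? : Dec A) → A → ∀ {z} → when A? z ≡ z
  when-yes (yes _) _ = refl
  when-yes (no ¬a) a = contradiction a ¬a

  when-no : (A? : Dec A) → ¬ A → ∀ {z} → when A? z ≡ 0ℤ
  when-no (yes a) ¬a = contradiction a ¬a
  when-no (no _)  _  = refl

  when-0 : (A? : Dec A) → when A? 0ℤ ≡ 0ℤ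
  when-0 (yes _) = refl
  when-0 (no _)  = refl

  when-* : (A? : Dec A) → ∀ c z → c ℤ.* when A? z ≡ when A? (c ℤ.* z)
  when-* (yes _) c z = refl
  when-* (no _)  c z = ℤₚ.*-zeroʳ c

-- The values have to agree only under the condition, which is where induction hypotheses such as
-- those about `z < y` are available.
when-cong : ∀ {ℓ ℓ′} {A : Set ℓ} {B : Set ℓ′} (A? : Dec A) (B? : Dec B) → (A → B) → (B → A) →
            ∀ {y z} → (A → y ≡ z) → when A? y ≡ when B? z
when-cong (yes a) B? f g eq = trans (eq a) (sym (when-yes B? (f a)))
when-cong (no ¬a) B? f g eq = sym (when-no B? (λ b → ¬a (g b)))

module _ {A : Set} where

  ∑ : List A → (A → ℤ) → ℤ
  ∑ xs f = foldr ℤ._+_ 0ℤ (map f xs)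

  ∑-cong : ∀ xs {f g : A → ℤ} → (∀ x → f x ≡ g x) → ∑ xs f ≡ ∑ xs g
  ∑-cong []       eq = refl
  ∑-cong (x ∷ xs) eq = cong₂ ℤ._+_ (eq x) (∑-cong xs eq)

  ∑-zero : ∀ xs {f : A → ℤ} → (∀ x → f x ≡ 0ℤ) → ∑ xs f ≡ 0ℤ
  ∑-zero []       eq = refl
  ∑-zero (x ∷ xs) eq = cong₂ ℤ._+_ (eq x) (∑-zero xs eq)

  ∑-+ : ∀ xs (f g : A → ℤ) → ∑ xs (λ x → f x ℤ.+ g x) ≡ ∑ xs f ℤ.+ ∑ xs g
  ∑-+ []       f g = refl
  ∑-+ (x ∷ xs) f g = trans (cong (ℤ._+_ (f x ℤ.+ g x)) (∑-+ xs f g))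
                           (lemma (f x) (g x) (∑ xs f) (∑ xs g))
    where
    lemma : ∀ a b c d → (a ℤ.+ b) ℤ.+ (c ℤ.+ d) ≡ (a ℤ.+ c) ℤ.+ (b ℤ.+ d)
    lemma = solve-∀

  ∑-*ˡ : ∀ xs c (f : A → ℤ) → ∑ xs (λ x → c ℤ.* f x) ≡ c ℤ.* ∑ xs f
  ∑-*ˡ []       c f = sym (ℤₚ.*-zeroʳ c)
  ∑-*ˡ (x ∷ xs) c f = trans (cong (ℤ._+_ (c ℤ.* f x)) (∑-*ˡ xs c f))
                            (sym (ℤₚ.*-distribˡ-+ c (f x) (∑ xs f)))

  ∑-neg : ∀ xs (f : A → ℤ) → ∑ xs (λ x → ℤ.- f x) ≡ ℤ.- ∑ xs f
  ∑-neg []       f = refl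
  ∑-neg (x ∷ xs) f = trans (cong (ℤ._+_ (ℤ.- f x)) (∑-neg xs f)) (sym (ℤₚ.neg-distrib-+ (f x) (∑ xs f)))

  ∑-filter : ∀ {B : A → Set} (B? : U.Decidable B) xs (f : A → ℤ) →
             ∑ (filter B? xs) f ≡ ∑ xs (λ x → when (B? x) (f x))
  ∑-filter B? []       f = refl
  ∑-filter B? (x ∷ xs) f with does (B? x)
  ... | true  = cong (ℤ._+_ (f x)) (∑-filter B? xs f)
  ... | false = trans (∑-filter B? xs f) (sym (ℤₚ.+-identityˡ _))

  ∑-1≡length : ∀ (xs : List A) → ∑ xs (λ _ → 1ℤ) ≡ + length xs
  ∑-1≡length []       = refl
  ∑-1≡length (x ∷ xs) = cong (ℤ._+_ 1ℤ) (∑-1≡length xs)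

  ∑-nonNeg : ∀ xs {f : A → ℤ} → (∀ x → 0ℤ ℤ.≤ f x) → 0ℤ ℤ.≤ ∑ xs f
  ∑-nonNeg []       f≥0 = ℤₚ.≤-refl
  ∑-nonNeg (x ∷ xs) f≥0 = ℤₚ.+-mono-≤ (f≥0 x) (∑-nonNeg xs f≥0)

∑-swap : ∀ {A B : Set} xs ys (f : A → B → ℤ) →
         ∑ xs (λ x → ∑ ys (f x)) ≡ ∑ ys (λ y → ∑ xs (λ x → f x y))
∑-swap []       ys f = sym (∑-zero ys (λ _ → refl))
∑-swap (x ∷ xs) ys f = trans (cong (ℤ._+_ (∑ ys (f x))) (∑-swap xs ys f))
                             (sym (∑-+ ys (f x) (λ y → ∑ xs (λ x → f x y))))

-- Sums over enumerations of finite setoids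

module FiniteSetoid (S : DecSetoid 0ℓ 0ℓ) {xs : List (DecSetoid.Carrier S)}
                    (enum : IsEnumeration (DecSetoid.setoid S) xs)
                    (uniq : Unique (DecSetoid.setoid S) xs) where
  open DecSetoid S renaming (refl to ≈-refl; sym to ≈-sym; trans to ≈-trans)
  open Membership setoid using (_∈_)

  private
    ∑-absent : ∀ {ys y} {f : Carrier → ℤ} → All (λ z → ¬ y ≈ z) ys → ∑ ys (λ x → when (x ≟ y) (f x)) ≡ 0ℤ
    ∑-absent []               = refl
    ∑-absent {z ∷ zs} {y} (n ∷ ns) = cong₂ ℤ._+_ (when-no (z ≟ y) (λ e → n (≈-sym e))) (∑-absent ns)

    ∑-δ′ : ∀ {ys y} {f : Carrier → ℤ} → (∀ {x} → x ≈ y → f x ≡ f y) →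
           Unique setoid ys → y ∈ ys → ∑ ys (λ x → when (x ≟ y) (f x)) ≡ f y
    ∑-δ′ {z ∷ zs} {y} {f} f-cong (n ∷ u) (here y≈z) = trans
      (cong₂ ℤ._+_ (trans (when-yes (z ≟ y) (≈-sym y≈z)) (f-cong (≈-sym y≈z)))
                   (∑-absent (All.map (λ ¬e e → ¬e (≈-trans (≈-sym y≈z) e)) n)))
      (ℤₚ.+-identityʳ _)
    ∑-δ′ {z ∷ zs} {y} {f} f-cong (n ∷ u) (there y∈) = trans
      (cong₂ ℤ._+_ (when-no (z ≟ y) (λ z≈y → absurd n z≈y y∈)) (∑-δ′ f-cong u y∈))
      (ℤₚ.+-identityˡ _)
      where
      absurd : ∀ {zs} → All (λ w → ¬ z ≈ w) zs → z ≈ y → ¬ y ∈ zs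
      absurd (m ∷ _)  z≈y (here e)  = m (≈-trans z≈y e)
      absurd (_ ∷ ms) z≈y (there i) = absurd ms z≈y i

  -- The list contains exactly one representative of the class of `y`, not `y` itself; hence the
  -- condition on `f`.
  ∑-δ : ∀ y (f : Carrier → ℤ) → (∀ {x} → x ≈ y → f x ≡ f y) →
        ∑ xs (λ x → when (x ≟ y) (f x)) ≡ f y
  ∑-δ y f f-cong = ∑-δ′ f-cong uniq (enum y)

  ∑-pos : ∀ {f : Carrier → ℤ} → (∀ {x y} → x ≈ y → f x ≡ f y) → (∀ x → 0ℤ ℤ.≤ f x) →
          ∀ y → 0ℤ ℤ.< f y → 0ℤ ℤ.< ∑ xs f
  ∑-pos {f} f-cong f≥0 y fy>0 = go (enum y)
    where
    go : ∀ {ys} → y ∈ ys → 0ℤ ℤ.< ∑ ys f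
    go {z ∷ zs} (here y≈z) = ℤₚ.+-mono-<-≤ (subst (0ℤ ℤ.<_) (f-cong y≈z) fy>0) (∑-nonNeg zs f≥0)
    go {z ∷ zs} (there i)  = ℤₚ.+-mono-≤-< (f≥0 z) (go i)

module _ (S T : DecSetoid 0ℓ 0ℓ) where
  private
    module S = DecSetoid S
    module T = DecSetoid T

  -- Both sides equal the double sum of `g y` over the pairs with `y ≈ f x`, since each fibre over
  -- the support of `g` is a single class. Surjectivity is asked only where `g` is nonzero, so that
  -- `f` may be the inclusion of a down-set.
  ∑-reindex : ∀ {xs ys} →
    IsEnumeration S.setoid xs → Unique S.setoid xs → IsEnumeration T.setoid ys → Unique T.setoid ys →
    (f : S.Carrier → T.Carrier) →
    (∀ {x y} → x S.≈ y → f x T.≈ f y) → (∀ {x y} → f x T.≈ f y → x S.≈ y) →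
    (g : T.Carrier → ℤ) → (∀ {x y} → x T.≈ y → g x ≡ g y) →
    (∀ y → (∃[ x ] f x T.≈ y) ⊎ g y ≡ 0ℤ) →
    ∑ xs (λ x → g (f x)) ≡ ∑ ys g
  ∑-reindex {xs} {ys} ex ux ey uy f f-cong f-inj g g-cong support = begin
    ∑ xs (λ x → g (f x))
      ≡⟨ ∑-cong xs (λ x → FiniteSetoid.∑-δ T ey uy (f x) g g-cong) ⟨
    ∑ xs (λ x → ∑ ys (λ y → when (y T.≟ f x) (g y)))
      ≡⟨ ∑-swap xs ys _ ⟩
    ∑ ys (λ y → ∑ xs (λ x → when (y T.≟ f x) (g y)))
      ≡⟨ ∑-cong ys fibre ⟩
    ∑ ys g ∎
    where
    open ≡-Reasoning
    fibre : ∀ y → ∑ xs (λ x → when (y T.≟ f x) (g y)) ≡ g y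
    fibre y with support y
    ... | inj₁ (x₀ , fx₀≈y) = trans
      (∑-cong xs (λ x → when-cong (y T.≟ f x) (x S.≟ x₀)
         (λ y≈fx → f-inj (T.trans (T.sym y≈fx) (T.sym fx₀≈y)))
         (λ x≈x₀ → T.trans (T.sym fx₀≈y) (f-cong (S.sym x≈x₀))) (λ _ → refl)))
      (FiniteSetoid.∑-δ S ex ux x₀ (λ _ → g y) (λ _ → refl))
    ... | inj₂ gy≡0 = trans
      (∑-zero xs (λ x → trans (cong (when (y T.≟ f x)) gy≡0) (when-0 (y T.≟ f x)))) (sym gy≡0)

-- Polynomials

coeff-+ : ∀ p q n → coeff (p +ₚ q) n ≡ coeff p n ℤ.+ coeff q n
coeff-+ []      q       n       = sym (ℤₚ.+-identityˡ _)
coeff-+ (c ∷ p) []      n       = sym (ℤₚ.+-identityʳ _)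
coeff-+ (c ∷ p) (d ∷ q) zero    = refl
coeff-+ (c ∷ p) (d ∷ q) (suc n) = coeff-+ p q n

coeff-· : ∀ c p n → coeff (c ·ₚ p) n ≡ c ℤ.* coeff p n
coeff-· c []      n       = sym (ℤₚ.*-zeroʳ c)
coeff-· c (d ∷ p) zero    = refl
coeff-· c (d ∷ p) (suc n) = coeff-· c p n

coeff-monomial : ∀ c m n → coeff (monomial c m) n ≡ when (m ℕₚ.≟ n) c
coeff-monomial c zero    zero    = refl
coeff-monomial c zero    (suc n) = refl
coeff-monomial c (suc m) zero    = refl
coeff-monomial c (suc m) (suc n) = trans (coeff-monomial c m n)
  (when-cong (m ℕₚ.≟ n) (suc m ℕₚ.≟ suc n) (cong suc) ℕₚ.suc-injective (λ _ → refl))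

coeff-∑ : ∀ {A : Set} (xs : List A) (f : A → Poly) n →
          coeff (foldr _+ₚ_ [] (map f xs)) n ≡ ∑ xs (λ x → coeff (f x) n)
coeff-∑ []       f n = refl
coeff-∑ (x ∷ xs) f n = trans (coeff-+ (f x) _ n) (cong (ℤ._+_ (coeff (f x) n)) (coeff-∑ xs f n))

-- The Cauchy product, peeling off the lowest coefficient of the left factor as `_*ₚ_` does. It sees
-- only coefficient functions, so it is blind to trailing zeros and respects `_≈ₚ_` in both
-- arguments.
convolve : (ℕ → ℤ) → (ℕ → ℤ) → ℕ → ℤ
convolve f g zero    = f 0 ℤ.* g 0
convolve f g (suc n) = f 0 ℤ.* g (suc n) ℤ.+ convolve (f ∘ suc) g n

convolve-cong : ∀ {f f′ g g′} → (∀ n → f n ≡ f′ n) → (∀ n → g n ≡ g′ n) →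
                ∀ n → convolve f g n ≡ convolve f′ g′ n
convolve-cong f≡ g≡ zero    = cong₂ ℤ._*_ (f≡ 0) (g≡ 0)
convolve-cong f≡ g≡ (suc n) =
  cong₂ ℤ._+_ (cong₂ ℤ._*_ (f≡ 0) (g≡ (suc n))) (convolve-cong (f≡ ∘ suc) g≡ n)

convolve-zeroˡ : ∀ {f} g → (∀ n → f n ≡ 0ℤ) → ∀ n → convolve f g n ≡ 0ℤ
convolve-zeroˡ g f≡0 zero    = cong (ℤ._* g 0) (f≡0 0)
convolve-zeroˡ g f≡0 (suc n) =
  cong₂ ℤ._+_ (cong (ℤ._* g (suc n)) (f≡0 0)) (convolve-zeroˡ g (f≡0 ∘ suc) n)

convolve-constˡ : ∀ {f} g → (∀ n → f (suc n) ≡ 0ℤ) → ∀ n → convolve f g n ≡ f 0 ℤ.* g n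
convolve-constˡ g f≡0 zero    = refl
convolve-constˡ {f} g f≡0 (suc n) =
  trans (cong (ℤ._+_ (f 0 ℤ.* g (suc n))) (convolve-zeroˡ g f≡0 n)) (ℤₚ.+-identityʳ (f 0 ℤ.* g (suc n)))

coeff-* : ∀ p q n → coeff (p *ₚ q) n ≡ convolve (coeff p) (coeff q) n
coeff-* []      q n       = sym (convolve-zeroˡ (coeff q) (λ _ → refl) n)
coeff-* (c ∷ p) q zero    = trans (coeff-+ (c ·ₚ q) _ 0)
  (trans (ℤₚ.+-identityʳ _) (coeff-· c q 0))
coeff-* (c ∷ p) q (suc n) = trans (coeff-+ (c ·ₚ q) _ (suc n))
  (cong₂ ℤ._+_ (coeff-· c q (suc n)) (coeff-* p q n))

*ₚ-cong : ∀ {p p′ q q′} → p ≈ₚ p′ → q ≈ₚ q′ → p *ₚ q ≈ₚ p′ *ₚ q′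
*ₚ-cong {p} {p′} {q} {q′} p≈p′ q≈q′ n =
  trans (coeff-* p q n) (trans (convolve-cong p≈p′ q≈q′ n) (sym (coeff-* p′ q′ n)))

∣ₚ-resp : ∀ {p p′ q q′} → p ≈ₚ p′ → q ≈ₚ q′ → p ∣ₚ q → p′ ∣ₚ q′
∣ₚ-resp {p} {p′} p≈p′ q≈q′ (s , sp≈q) =
  s , λ n → trans (*ₚ-cong {s} {s} {p′} {p} (λ _ → refl) (λ m → sym (p≈p′ m)) n) (trans (sp≈q n) (q≈q′ n))

-- Monic polynomials and their cofactors

record Monic (n : ℕ) (p : Poly) : Set where
  field
    leading : coeff p n ≡ 1ℤ
    above   : ∀ {m} → n ℕ.< m → coeff p m ≡ 0ℤ

module _ {n p} (p-monic : Monic n p) where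
  open Monic p-monic

  private
    times-above : ∀ c {m} z → n ℕ.< m → c ℤ.* coeff p m ℤ.+ z ≡ z
    times-above c z n<m = trans (cong (ℤ._+ z) (trans (cong (ℤ._*_ c) (above n<m)) (ℤₚ.*-zeroʳ c)))
                                (ℤₚ.+-identityˡ z)

    times-leading : ∀ c → c ℤ.* coeff p n ≡ c
    times-leading c = trans (cong (ℤ._*_ c) leading) (ℤₚ.*-identityʳ c)

  -- Above degree `n` the lowest coefficient `c` of the cofactor contributes nothing, so the tail
  -- satisfies the hypothesis with `k` lowered by one. For `k = 0` the tail vanishes by recursion,
  -- the product is then `c` times `p`, and its coefficient at `n` is `c`. The recursion ends with
  -- the list: for power series the statement fails, as (t - 1) times a geometric series shows.
  cofactor-vanishes : ∀ k q → (∀ {m} → n ℕ.+ k ℕ.≤ m → convolve (coeff q) (coeff p) m ≡ 0ℤ) →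
                      ∀ {j} → k ℕ.≤ j → coeff q j ≡ 0ℤ
  cofactor-vanishes k []      qp≡0 k≤j = refl
  cofactor-vanishes zero (c ∷ q) qp≡0 {j} _ = by-index j
    where
    tail : ∀ j → coeff q j ≡ 0ℤ
    tail j = cofactor-vanishes zero q
      (λ {m} n≤m → let n≤m′ = subst (ℕ._≤ m) (ℕₚ.+-identityʳ n) n≤m in
        trans (sym (times-above c _ (ℕ.s≤s n≤m′)))
              (qp≡0 (subst (ℕ._≤ suc m) (sym (ℕₚ.+-identityʳ n)) (ℕₚ.m≤n⇒m≤1+n n≤m′)))) {j} ℕ.z≤n

    by-index : ∀ j → coeff (c ∷ q) j ≡ 0ℤ
    by-index zero    = trans (sym (times-leading c)) (trans (sym (convolve-constˡ (coeff p) tail n))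
                         (qp≡0 (ℕₚ.≤-reflexive (ℕₚ.+-identityʳ n))))
    by-index (suc j) = tail j
  cofactor-vanishes (suc k) (c ∷ q) qp≡0 {suc j} (ℕ.s≤s k≤j) = cofactor-vanishes k q
    (λ {m} n+k≤m → trans (sym (times-above c _ (ℕ.s≤s (ℕₚ.≤-trans (ℕₚ.m≤m+n n k) n+k≤m))))
       (qp≡0 (subst (ℕ._≤ suc m) (sym (ℕₚ.+-suc n k)) (ℕ.s≤s n+k≤m)))) k≤j

-- The coefficient below the leading one of a monic p of degree n is written
-- coeff (0ℤ ∷ p) n, so that it is 0 for n = 0.
monic-cofactor : ∀ {n p a} → Monic n p → Monic (suc n) a → p ∣ₚ a →
                 a ≈ₚ (t- (coeff (0ℤ ∷ p) n ℤ.- coeff a n)) *ₚ p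
monic-cofactor {n} {p} {a} p-monic a-monic (q , qp≈a) m =
  trans (sym (qp≈a m)) (*ₚ-cong {q} {t- (coeff (0ℤ ∷ p) n ℤ.- coeff a n)} {p} {p} q≈ (λ _ → refl) m)
  where
  open Monic
  qp : ∀ m → convolve (coeff q) (coeff p) m ≡ coeff a m
  qp m = trans (sym (coeff-* q p m)) (qp≈a m)

  -- Since `a` vanishes above degree n + 1, `q` has degree at most one. Comparing coefficients at n
  -- + 1 then gives q₁ = 1, and at n it gives q₀ plus the coefficient of `p` below the leading one.
  q₂₊ : ∀ j → coeff q (2 ℕ.+ j) ≡ 0ℤ
  q₂₊ j = cofactor-vanishes p-monic 2 q
    (λ {m} n+2≤m → trans (qp m) (above a-monic (subst (ℕ._≤ m) (ℕₚ.+-comm n 2) n+2≤m)))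
    (ℕ.s≤s (ℕ.s≤s ℕ.z≤n))

  shifted : ∀ m → convolve (coeff q ∘ suc) (coeff p) m ≡ coeff q 1 ℤ.* coeff p m
  shifted = convolve-constˡ (coeff p) q₂₊

  q₁ : coeff q 1 ≡ 1ℤ
  q₁ = begin
    coeff q 1
      ≡⟨ ℤₚ.*-identityʳ _ ⟨
    coeff q 1 ℤ.* 1ℤ
      ≡⟨ cong (ℤ._*_ (coeff q 1)) (leading p-monic) ⟨
    coeff q 1 ℤ.* coeff p n
      ≡⟨ shifted n ⟨
    convolve (coeff q ∘ suc) (coeff p) n
      ≡⟨ ℤₚ.+-identityˡ _ ⟨
    0ℤ ℤ.+ convolve (coeff q ∘ suc) (coeff p) n
      ≡⟨ cong (ℤ._+ convolve (coeff q ∘ suc) (coeff p) n) (trans (cong (ℤ._*_ (coeff q 0)) (above p-monic ℕₚ.≤-refl)) (ℤₚ.*-zeroʳ (coeff q 0))) ⟨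
    convolve (coeff q) (coeff p) (suc n)
      ≡⟨ qp (suc n) ⟩
    coeff a (suc n)
      ≡⟨ leading a-monic ⟩
    1ℤ ∎
    where open ≡-Reasoning

  subleading : ∀ n → coeff p n ≡ 1ℤ →
               convolve (coeff q) (coeff p) n ≡ coeff q 0 ℤ.+ coeff (0ℤ ∷ p) n
  subleading zero    p₀≡1 = trans (cong (ℤ._*_ (coeff q 0)) p₀≡1)
    (trans (ℤₚ.*-identityʳ (coeff q 0)) (sym (ℤₚ.+-identityʳ (coeff q 0))))
  subleading (suc n) p₁₊ₙ≡1 = cong₂ ℤ._+_
    (trans (cong (ℤ._*_ (coeff q 0)) p₁₊ₙ≡1) (ℤₚ.*-identityʳ (coeff q 0)))
    (trans (shifted n) (trans (cong (ℤ._* coeff p n) q₁) (ℤₚ.*-identityˡ _)))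

  q≈ : q ≈ₚ t- (coeff (0ℤ ∷ p) n ℤ.- coeff a n)
  q≈ 0 = begin
    coeff q 0
      ≡⟨ lemma (coeff q 0) (coeff (0ℤ ∷ p) n) ⟩
    ℤ.- (coeff (0ℤ ∷ p) n ℤ.- (coeff q 0 ℤ.+ coeff (0ℤ ∷ p) n))
      ≡⟨ cong (λ z → ℤ.- (coeff (0ℤ ∷ p) n ℤ.- z)) (trans (sym (subleading n (leading p-monic))) (qp n)) ⟩
    ℤ.- (coeff (0ℤ ∷ p) n ℤ.- coeff a n) ∎
    where
    open ≡-Reasoning
    lemma : ∀ x y → x ≡ ℤ.- (y ℤ.- (x ℤ.+ y))
    lemma = solve-∀
  q≈ 1             = q₁
  q≈ (suc (suc j)) = q₂₊ j

-- Evaluation in commutative rings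

module Evaluation (K : CommutativeRing 0ℓ 0ℓ) where
  open CommutativeRing K
    using (Carrier; _≈_; 0#; 1#; _+_; _*_; -_; _-_; setoid; ring; +-monoid; +-commutativeMonoid;
           +-cong; +-congˡ; +-congʳ; +-comm; +-identityˡ; +-identityʳ; -‿cong; -‿inverseʳ;
           *-congˡ; *-congʳ; *-assoc; *-comm; *-identityˡ; distribˡ; distribʳ; zeroˡ; zeroʳ)
    renaming (refl to ≈-refl; sym to ≈-sym; trans to ≈-trans; reflexive to ≈-reflexive)
  open MultProperties +-monoid using (×-homo-+; ×-homo-1) renaming (_×_ to _times_)
  open RingProperties ring
    using (-‿distribˡ-*; -‿involutive; -0#≈0#; -‿+-comm; x∙y⁻¹≈ε⇒x≈y)
  open CommutativeSemigroupProperties (CommutativeMonoid.commutativeSemigroup +-commutativeMonoid)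
    using (interchange)
  open SetoidReasoning setoid

  private
    ι : ℤ → Carrier
    ι = fromℤ K

  fromℤ-neg : ∀ i → ι (ℤ.- i) ≈ - ι i
  fromℤ-neg (+ zero)  = ≈-sym -0#≈0#
  fromℤ-neg (+ suc n) = ≈-refl
  fromℤ-neg -[1+ n ]  = ≈-sym (-‿involutive _)

  fromℤ-⊖ : ∀ m n → ι (m ℤ.⊖ n) ≈ m times 1# - n times 1#
  fromℤ-⊖ m zero          = ≈-sym (≈-trans (+-congˡ -0#≈0#) (+-identityʳ _))
  fromℤ-⊖ zero (suc n)    = ≈-sym (+-identityˡ _)
  fromℤ-⊖ (suc m) (suc n) = begin
    ι (suc m ℤ.⊖ suc n)                      ≡⟨ cong ι (ℤₚ.[1+m]⊖[1+n]≡m⊖n m n) ⟩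
    ι (m ℤ.⊖ n)                              ≈⟨ fromℤ-⊖ m n ⟩
    m times 1# - n times 1#                  ≈⟨ +-identityˡ _ ⟨
    0# + (m times 1# - n times 1#)           ≈⟨ +-congʳ (-‿inverseʳ 1#) ⟨
    1# - 1# + (m times 1# - n times 1#)      ≈⟨ interchange 1# (- 1#) (m times 1#) (- (n times 1#)) ⟩
    (1# + m times 1#) + (- 1# - n times 1#)  ≈⟨ +-congˡ (-‿+-comm 1# (n times 1#)) ⟩
    suc m times 1# - suc n times 1#          ∎

  fromℤ-+ : ∀ i j → ι (i ℤ.+ j) ≈ ι i + ι j
  fromℤ-+ (+ m)    (+ n)    = ×-homo-+ 1# m n
  fromℤ-+ (+ m)    -[1+ n ] = fromℤ-⊖ m (suc n)
  fromℤ-+ -[1+ m ] (+ n)    = ≈-trans (fromℤ-⊖ n (suc m)) (+-comm _ _)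
  fromℤ-+ -[1+ m ] -[1+ n ] = begin
    - (suc (suc (m ℕ.+ n)) times 1#)       ≡⟨ cong (λ k → - (k times 1#)) (sym (cong suc (ℕₚ.+-suc m n))) ⟩
    - ((suc m ℕ.+ suc n) times 1#)         ≈⟨ -‿cong (×-homo-+ 1# (suc m) (suc n)) ⟩
    - (suc m times 1# + suc n times 1#)    ≈⟨ -‿+-comm (suc m times 1#) (suc n times 1#) ⟨
    - (suc m times 1#) - suc n times 1#    ∎

  private
    fromℤ-pos-* : ∀ m j → ι (+ m ℤ.* j) ≈ m times 1# * ι j
    fromℤ-pos-* zero    j = ≈-sym (zeroˡ (ι j))
    fromℤ-pos-* (suc m) j = begin
      ι (+ suc m ℤ.* j)          ≡⟨ cong ι (ℤₚ.suc-* (+ m) j) ⟩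
      ι (j ℤ.+ + m ℤ.* j)        ≈⟨ fromℤ-+ j (+ m ℤ.* j) ⟩
      ι j + ι (+ m ℤ.* j)        ≈⟨ +-cong (≈-sym (*-identityˡ (ι j))) (fromℤ-pos-* m j) ⟩
      1# * ι j + m times 1# * ι j ≈⟨ distribʳ (ι j) 1# (m times 1#) ⟨
      suc m times 1# * ι j       ∎

  fromℤ-* : ∀ i j → ι (i ℤ.* j) ≈ ι i * ι j
  fromℤ-* (+ m)    j = fromℤ-pos-* m j
  fromℤ-* -[1+ m ] j = begin
    ι (-[1+ m ] ℤ.* j)       ≡⟨ cong ι (ℤₚ.neg-distribˡ-* (+ suc m) j) ⟨
    ι (ℤ.- (+ suc m ℤ.* j))  ≈⟨ fromℤ-neg (+ suc m ℤ.* j) ⟩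
    - ι (+ suc m ℤ.* j)      ≈⟨ -‿cong (fromℤ-pos-* (suc m) j) ⟩
    - (suc m times 1# * ι j) ≈⟨ -‿distribˡ-* (suc m times 1#) (ι j) ⟩
    ι -[1+ m ] * ι j         ∎

  module _ (x : Carrier) where

    eval-zero : ∀ p → (∀ n → coeff p n ≡ 0ℤ) → eval K p x ≈ 0#
    eval-zero []      p≈0 = ≈-refl
    eval-zero (c ∷ p) p≈0 = begin
      ι c + x * eval K p x ≈⟨ +-cong (≈-reflexive (cong ι (p≈0 0))) (*-congˡ (eval-zero p (p≈0 ∘ suc))) ⟩
      0# + x * 0#          ≈⟨ +-identityˡ (x * 0#) ⟩
      x * 0#               ≈⟨ zeroʳ x ⟩
      0#                   ∎

    eval-cong : ∀ p q → p ≈ₚ q → eval K p x ≈ eval K q x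
    eval-cong []      q       p≈q = ≈-sym (eval-zero q (λ n → sym (p≈q n)))
    eval-cong (c ∷ p) []      p≈q = eval-zero (c ∷ p) p≈q
    eval-cong (c ∷ p) (d ∷ q) p≈q =
      +-cong (≈-reflexive (cong ι (p≈q 0))) (*-congˡ (eval-cong p q (p≈q ∘ suc)))

    eval-+ : ∀ p q → eval K (p +ₚ q) x ≈ eval K p x + eval K q x
    eval-+ []      q       = ≈-sym (+-identityˡ (eval K q x))
    eval-+ (c ∷ p) []      = ≈-sym (+-identityʳ (eval K (c ∷ p) x))
    eval-+ (c ∷ p) (d ∷ q) = begin
      ι (c ℤ.+ d) + x * eval K (p +ₚ q) x
        ≈⟨ +-cong (fromℤ-+ c d) (≈-trans (*-congˡ (eval-+ p q)) (distribˡ x _ _)) ⟩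
      (ι c + ι d) + (x * eval K p x + x * eval K q x)
        ≈⟨ interchange (ι c) (ι d) _ _ ⟩
      (ι c + x * eval K p x) + (ι d + x * eval K q x) ∎

    eval-· : ∀ c p → eval K (c ·ₚ p) x ≈ ι c * eval K p x
    eval-· c []      = ≈-sym (zeroʳ (ι c))
    eval-· c (d ∷ p) = begin
      ι (c ℤ.* d) + x * eval K (c ·ₚ p) x
        ≈⟨ +-cong (fromℤ-* c d) (*-congˡ (eval-· c p)) ⟩
      ι c * ι d + x * (ι c * eval K p x)
        ≈⟨ +-congˡ (≈-trans (≈-sym (*-assoc x (ι c) _)) (≈-trans (*-congʳ (*-comm x (ι c))) (*-assoc (ι c) x _))) ⟩
      ι c * ι d + ι c * (x * eval K p x)
        ≈⟨ distribˡ (ι c) (ι d) _ ⟨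
      ι c * eval K (d ∷ p) x ∎

    eval-shift : ∀ p → eval K (0ℤ ∷ p) x ≈ x * eval K p x
    eval-shift p = +-identityˡ (x * eval K p x)

    eval-* : ∀ p q → eval K (p *ₚ q) x ≈ eval K p x * eval K q x
    eval-* []      q = ≈-sym (zeroˡ (eval K q x))
    eval-* (c ∷ p) q = begin
      eval K (c ·ₚ q +ₚ (0ℤ ∷ p *ₚ q)) x
        ≈⟨ eval-+ (c ·ₚ q) (0ℤ ∷ p *ₚ q) ⟩
      eval K (c ·ₚ q) x + eval K (0ℤ ∷ p *ₚ q) x
        ≈⟨ +-cong (eval-· c q) (≈-trans (eval-shift (p *ₚ q)) (*-congˡ (eval-* p q))) ⟩
      ι c * eval K q x + x * (eval K p x * eval K q x)
        ≈⟨ +-congˡ (*-assoc x _ _) ⟨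
      ι c * eval K q x + x * eval K p x * eval K q x
        ≈⟨ distribʳ (eval K q x) (ι c) _ ⟨
      eval K (c ∷ p) x * eval K q x ∎

    eval-constant : ∀ c → eval K [ c ] x ≈ ι c
    eval-constant c = ≈-trans (+-congˡ (zeroʳ x)) (+-identityʳ (ι c))

    root-of-linear : ∀ d → eval K (t- d) x ≈ 0# → x ≈ ι d
    root-of-linear d root = x∙y⁻¹≈ε⇒x≈y x (ι d) (begin
      x - ι d                       ≈⟨ +-comm x (- ι d) ⟩
      - ι d + x                     ≈⟨ +-cong (≈-sym (fromℤ-neg d)) (≈-sym x1≈x) ⟩
      eval K (t- d) x               ≈⟨ root ⟩
      0#                            ∎)
      where
      x1≈x : x * eval K [ 1ℤ ] x ≈ x
      x1≈x = ≈-trans (*-congˡ (≈-trans (eval-constant 1ℤ) (×-homo-1 1#)))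
                     (≈-trans (*-comm x 1#) (*-identityˡ x))

-- Roots of products of linear factors

∏ₚ : List ℤ → Poly
∏ₚ = foldr (λ d q → (t- d) *ₚ q) [ 1ℤ ]

roots-positive : ∀ {p ds} → p ≈ₚ ∏ₚ ds → All (0ℤ ℤ.<_) ds → AllRootsPositiveIntegers p
roots-positive {p} {ds} p≈∏ ds>0 K domain x root =
  go ds>0 (≈-trans (eval-cong x (∏ₚ ds) p (λ n → sym (p≈∏ n))) root)
  where
  open CommutativeRing K using (_≈_; 0#) renaming (sym to ≈-sym; trans to ≈-trans)
  open Evaluation K
  open IsCharZeroDomain domain
  go : ∀ {ds} → All (0ℤ ℤ.<_) ds → eval K (∏ₚ ds) x ≈ 0# → ∃[ n ] x ≈ fromℤ K (+ suc n)
  -- The empty product evaluates to `1 times 1#`, which is nonzero by `charZero 0`.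
  go []                                   root = contradiction (≈-trans (≈-sym (eval-constant x 1ℤ)) root) (charZero 0)
  -- Matching on `0ℤ < d` forces `d = + suc n`, which supplies the witness `n`.
  go {d ∷ ds} (ℤ.+<+ (ℕ.s≤s {n = n} _) ∷ ds>0) root
    with noZeroDivisors _ _ (≈-trans (≈-sym (eval-* x (t- d) (∏ₚ ds))) root)
  ... | inj₁ linear = n , root-of-linear x d linear
  ... | inj₂ rest   = go ds>0 rest

-- Ranked posets

module RankedPosetProperties (P : RankedPoset) where
  open RankedPoset P
  open StrictPartialOrder (PosetProperties.<-strictPartialOrder (DecPoset.poset decPoset)) public
    using (<-respˡ-≈; <-respʳ-≈)

  decSetoid : DecSetoid 0ℓ 0ℓ
  decSetoid = DecPoset.Eq.decSetoid decPoset

  open FiniteSetoid decSetoid enumerates unique public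

  search : ∀ {Q : Carrier → Set} (Q? : U.Decidable Q) → (∀ {x y} → x ≈ y → Q x → Q y) → Dec (∃[ x ] Q x)
  search Q? Q-resp with any? Q? elements
  ... | yes found = yes (satisfied found)
  ... | no  none  = no λ (x , q) → none (Any.map (λ x≈y → Q-resp x≈y q) (enumerates x))

  between? : ∀ x y → Dec (∃[ z ] x < z × z < y)
  between? x y = search (λ z → (x <? z) ×-dec (z <? y))
    (λ u≈v (x<u , u<y) → <-respʳ-≈ u≈v x<u , <-respˡ-≈ u≈v u<y)

  -- Descend from `y`: as long as some element lies strictly between, move to it; the rank drops
  -- each time.
  cover-below : ∀ {x y} → x < y → ∃[ z ] x ⋖ z × z ≤ y
  cover-below {x} {y} x<y = go y x<y (<-wellFounded (rk y))
    where
    go : ∀ y → x < y → Acc ℕ._<_ (rk y) → ∃[ z ] x ⋖ z × z ≤ y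
    go y x<y (acc rec) with between? x y
    ... | yes (z , x<z , z<y) = let (w , x⋖w , w≤z) = go z x<z (rec (rk-mono-< z<y)) in
                                w , x⋖w , ≤-trans w≤z (proj₁ z<y)
    ... | no  none            = y , (x<y , λ z b → none (z , b)) , ≤-refl

  ≈-by-rank : ∀ {x y} → x ≤ y → rk y ℕ.≤ rk x → x ≈ y
  ≈-by-rank {x} {y} x≤y rky≤rkx with x ≟ y
  ... | yes x≈y = x≈y
  ... | no  x≉y = contradiction (rk-mono-< (x≤y , x≉y)) (ℕₚ.≤⇒≯ rky≤rkx)

  ≤∧rk-suc⇒⋖ : ∀ {x y} → x ≤ y → rk y ≡ suc (rk x) → x ⋖ y
  ≤∧rk-suc⇒⋖ {x} {y} x≤y eq =
    (x≤y , λ x≈y → ℕₚ.1+n≢n (trans (sym eq) (rk-cong (Eq.sym x≈y)))) ,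
    λ z (x<z , z<y) → ℕₚ.<⇒≱ (rk-mono-< z<y) (subst (ℕ._≤ rk z) (sym eq) (rk-mono-< x<z))

  rk≡0⇒≈0̂ : ∀ {x} → rk x ≡ 0 → x ≈ 0̂
  rk≡0⇒≈0̂ {x} eq = Eq.sym (≈-by-rank (0̂-minimum x) (subst (ℕ._≤ rk 0̂) (sym eq) ℕ.z≤n))

  ≉0̂⇒0̂< : ∀ {x} → ¬ x ≈ 0̂ → 0̂ < x
  ≉0̂⇒0̂< x≉0̂ = 0̂-minimum _ , λ 0̂≈x → x≉0̂ (Eq.sym 0̂≈x)

  atom-below : ∀ {x} → ¬ x ≈ 0̂ → ∃[ a ] Atom P a × a ≤ x
  atom-below x≉0̂ = let (a , 0̂⋖a , a≤x) = cover-below (≉0̂⇒0̂< x≉0̂) in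
    a , trans (rk-cover 0̂⋖a) (cong suc rk-0̂) , a≤x

  rk≤rank : ∀ x → rk x ℕ.≤ rank P
  rk≤rank x = v≤max⁺ 0 (map rk elements) (inj₂ (Anyₚ.map⁺ (Any.map (ℕₚ.≤-reflexive ∘ rk-cong) (enumerates x))))

  maximal-above : ∀ x → ∃[ m ] x ≤ m × Maximal m
  maximal-above x = go x (<-wellFounded (rank P ∸ rk x))
    where
    go : ∀ x → Acc ℕ._<_ (rank P ∸ rk x) → ∃[ m ] x ≤ m × Maximal m
    go x (acc rec) with search (x <?_) <-respʳ-≈
    ... | yes (y , x<y) = let (m , y≤m , max) = go y (rec (ℕₚ.∸-monoʳ-< (rk-mono-< x<y) (rk≤rank y))) in
                          m , ≤-trans (proj₁ x<y) y≤m , max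
    ... | no  none      = x , ≤-refl , λ y x≤y → decidable-stable (y ≟ x)
                            (λ y≉x → none (y , x≤y , λ x≈y → y≉x (Eq.sym x≈y)))

  -- Every element lies below a maximal one, whose rank is that of `m` by `rk-maximal`; so the
  -- maximum defining `rank` is attained at every maximal element.
  rank≡rk-maximal : ∀ {m} → Maximal m → rank P ≡ rk m
  rank≡rk-maximal {m} max = ℕₚ.≤-antisym
    (max≤v⁺ {xs = map rk elements} ℕ.z≤n (Allₚ.map⁺ (All.universal (λ x → bound x (maximal-above x)) elements)))
    (rk≤rank m)
    where
    bound : ∀ x → ∃[ m′ ] x ≤ m′ × Maximal m′ → rk x ℕ.≤ rk m
    bound x (m′ , x≤m′ , max′) = subst (rk x ℕ.≤_) (rk-maximal max′ max) (rk-mono-≤ x≤m′)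

  ∃-rank : ∃[ m ] rk m ≡ rank P
  ∃-rank = let (m , _ , max) = maximal-above 0̂ in m , sym (rank≡rk-maximal max)

  -- The Möbius function and its recursion without fuel

  private
    -- One unfolding of the recursion for μ, with `f` in place of the recursive calls and the filter
    -- replaced by zero terms.
    μ-sum : (Carrier → ℤ) → Carrier → Carrier → ℤ
    μ-sum f x y = if does (x ≟ y) then 1ℤ
      else ℤ.- ∑ elements (λ z → when ((x ≤? z) ×-dec (z <? y)) (f z))

    μ-sum-cong : ∀ {f g : Carrier → ℤ} {x} y → (∀ {z} → z < y → f z ≡ g z) → μ-sum f x y ≡ μ-sum g x y
    μ-sum-cong {x = x} y f≡g with does (x ≟ y)
    ... | true  = refl
    ... | false = cong ℤ.-_ (∑-cong elements (λ z →
      when-cong ((x ≤? z) ×-dec (z <? y)) ((x ≤? z) ×-dec (z <? y)) id id (f≡g ∘ proj₂)))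

    μ-fuel-suc : ∀ n x y → μ-fuel P (suc n) x y ≡ μ-sum (μ-fuel P n x) x y
    μ-fuel-suc n x y with does (x ≟ y)
    ... | true  = refl
    ... | false = cong ℤ.-_ (∑-filter (λ z → (x ≤? z) ×-dec (z <? y)) elements (μ-fuel P n x))

    -- Nothing lies strictly below an element of rank zero, so the sum is empty and the default
    -- value of exhausted fuel is the correct one.
    μ-sum-0 : ∀ f x y → rk y ℕ.≤ 0 → μ-sum f x y ≡ μ-fuel P 0 x y
    μ-sum-0 f x y rky≤0 with does (x ≟ y)
    ... | true  = refl
    ... | false = cong ℤ.-_ (∑-zero elements (λ z → when-no ((x ≤? z) ×-dec (z <? y))
                    (λ (_ , z<y) → ℕₚ.n≮0 (ℕₚ.<-≤-trans (rk-mono-< z<y) rky≤0))))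

    -- The rank drops at each recursive call, so fuel that covers the rank of `y` also covers the
    -- calls after one unit is spent.
    μ-fuel-stable : ∀ n k {x} y → rk y ℕ.≤ n → rk y ℕ.≤ k → μ-fuel P n x y ≡ μ-fuel P k x y
    μ-fuel-stable zero    zero    y p q = refl
    μ-fuel-stable zero    (suc k) y p q = sym (trans (μ-fuel-suc k _ y) (μ-sum-0 _ _ y p))
    μ-fuel-stable (suc n) zero    y p q = trans (μ-fuel-suc n _ y) (μ-sum-0 _ _ y q)
    μ-fuel-stable (suc n) (suc k) y p q = trans (μ-fuel-suc n _ y) (trans
      (μ-sum-cong y (λ {z} z<y → μ-fuel-stable n k z (ℕₚ.≤-pred (ℕₚ.≤-trans (rk-mono-< z<y) p))
                                                     (ℕₚ.≤-pred (ℕₚ.≤-trans (rk-mono-< z<y) q))))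
      (sym (μ-fuel-suc k _ y)))

    μ-rec : ∀ x y → μ P x y ≡ μ-sum (μ P x) x y
    μ-rec x y = trans (μ-fuel-stable (rk y) (suc (rk y)) y ℕₚ.≤-refl (ℕₚ.n≤1+n _))
      (trans (μ-fuel-suc (rk y) x y)
        (μ-sum-cong y (λ {z} z<y → μ-fuel-stable (rk y) (rk z) z (ℕₚ.<⇒≤ (rk-mono-< z<y)) ℕₚ.≤-refl)))

  μ₀ : Carrier → ℤ
  μ₀ = μ P 0̂

  μ₀-0̂ : ∀ {y} → y ≈ 0̂ → μ₀ y ≡ 1ℤ
  μ₀-0̂ {y} y≈0̂ with 0̂ ≟ y | μ-rec 0̂ y
  ... | yes _   | eq = eq
  ... | no 0̂≉y | _  = contradiction (Eq.sym y≈0̂) 0̂≉y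

  μ₀-rec : ∀ {y} → ¬ y ≈ 0̂ → μ₀ y ≡ ℤ.- ∑ elements (λ z → when (z <? y) (μ₀ z))
  μ₀-rec {y} y≉0̂ with 0̂ ≟ y | μ-rec 0̂ y
  ... | yes 0̂≈y | _  = contradiction (Eq.sym 0̂≈y) y≉0̂
  ... | no _     | eq = trans eq (cong ℤ.-_ (∑-cong elements (λ z →
    when-cong ((0̂ ≤? z) ×-dec (z <? y)) (z <? y) proj₂ (0̂-minimum z ,_) (λ _ → refl))))

  μ₀-cong : ∀ {y z} → y ≈ z → μ₀ y ≡ μ₀ z
  μ₀-cong {y} {z} y≈z with y ≟ 0̂
  ... | yes y≈0̂ = trans (μ₀-0̂ y≈0̂) (sym (μ₀-0̂ (Eq.trans (Eq.sym y≈z) y≈0̂)))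
  ... | no  y≉0̂ = trans (μ₀-rec y≉0̂) (trans
    (cong ℤ.-_ (∑-cong elements (λ x → when-cong (x <? y) (x <? z)
      (<-respʳ-≈ y≈z) (<-respʳ-≈ (Eq.sym y≈z)) (λ _ → refl))))
    (sym (μ₀-rec (λ z≈0̂ → y≉0̂ (Eq.trans y≈z z≈0̂)))))

  -- The recursion with the term of `y` itself moved into the sum. This sum over a closed interval
  -- is the one that Weisner's theorem regroups.
  ∑-μ₀-below : ∀ {y} → ¬ y ≈ 0̂ → ∑ elements (λ z → when (z ≤? y) (μ₀ z)) ≡ 0ℤ
  ∑-μ₀-below {y} y≉0̂ = begin
    ∑ elements (λ z → when (z ≤? y) (μ₀ z))
      ≡⟨ ∑-cong elements split ⟩
    ∑ elements (λ z → when (z ≟ y) (μ₀ z) ℤ.+ when (z <? y) (μ₀ z))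
      ≡⟨ ∑-+ elements _ _ ⟩
    ∑ elements (λ z → when (z ≟ y) (μ₀ z)) ℤ.+ strictly-below
      ≡⟨ cong (ℤ._+ strictly-below) (trans (∑-δ y μ₀ μ₀-cong) (μ₀-rec y≉0̂)) ⟩
    ℤ.- strictly-below ℤ.+ strictly-below
      ≡⟨ ℤₚ.+-inverseˡ strictly-below ⟩
    0ℤ ∎
    where
    open ≡-Reasoning
    strictly-below : ℤ
    strictly-below = ∑ elements (λ z → when (z <? y) (μ₀ z))
    split : ∀ z → when (z ≤? y) (μ₀ z) ≡ when (z ≟ y) (μ₀ z) ℤ.+ when (z <? y) (μ₀ z)
    split z = by-cases (z ≟ y)
      where
      by-cases : Dec (z ≈ y) → _
      by-cases (yes z≈y) = trans (when-yes (z ≤? y) (reflexive z≈y)) (sym (trans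
        (cong₂ ℤ._+_ (when-yes (z ≟ y) z≈y) (when-no (z <? y) (λ z<y → proj₂ z<y z≈y))) (ℤₚ.+-identityʳ (μ₀ z))))
      by-cases (no z≉y)  = trans (when-cong (z ≤? y) (z <? y) (_, z≉y) proj₁ (λ _ → refl)) (sym (trans
        (cong (ℤ._+ when (z <? y) (μ₀ z)) (when-no (z ≟ y) z≉y)) (ℤₚ.+-identityˡ _)))

-- A maximal element above `x` stays maximal in P≥x, so it realises the rank of both posets.
rank-upper : ∀ P x → rank (upper P x) ≡ rank P ∸ RankedPoset.rk P x
rank-upper P x =
  let open RankedPoset P
      (m , x≤m , max) = RankedPosetProperties.maximal-above P x
      max′ : RankedPoset.Maximal (upper P x) (m , x≤m)
      max′ = λ (y , _) → max y
  in trans (RankedPosetProperties.rank≡rk-maximal (upper P x) {m , x≤m} max′)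
       (cong (_∸ rk x) (sym (RankedPosetProperties.rank≡rk-maximal P max)))

-- Down-set embeddings and isomorphisms

record DownEmbedding (Q P : RankedPoset) : Set where
  private
    module Q = RankedPoset Q
    module P = RankedPoset P
  field
    to        : Q.Carrier → P.Carrier
    monotone  : ∀ {x y} → x Q.≤ y → to x P.≤ to y
    reflects  : ∀ {x y} → to x P.≤ to y → x Q.≤ y
    down-full : ∀ {x y} → y P.≤ to x → ∃[ z ] to z P.≈ y

  to-cong : ∀ {x y} → x Q.≈ y → to x P.≈ to y
  to-cong x≈y = P.antisym (monotone (Q.reflexive x≈y)) (monotone (Q.reflexive (Q.Eq.sym x≈y)))

  to-injective : ∀ {x y} → to x P.≈ to y → x Q.≈ y
  to-injective e = Q.antisym (reflects (P.reflexive e)) (reflects (P.reflexive (P.Eq.sym e)))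

  to-mono-< : ∀ {x y} → x Q.< y → to x P.< to y
  to-mono-< (x≤y , x≉y) = monotone x≤y , x≉y ∘ to-injective

  to-reflects-< : ∀ {x y} → to x P.< to y → x Q.< y
  to-reflects-< (x≤y , x≉y) = reflects x≤y , x≉y ∘ to-cong

  to-0̂ : to Q.0̂ P.≈ P.0̂
  to-0̂ = let (z , z≈0̂) = down-full (P.0̂-minimum (to Q.0̂)) in
    P.antisym (P.≤-trans (monotone (Q.0̂-minimum z)) (P.reflexive z≈0̂)) (P.0̂-minimum _)

module _ {Q P : RankedPoset} (e : DownEmbedding Q P) where
  private
    module Q where
      open RankedPoset Q public
      open RankedPosetProperties Q public
    module P where
      open RankedPoset P public
      open RankedPosetProperties P public
  open DownEmbedding e

  ∑-image : (g : P.Carrier → ℤ) → (∀ {x y} → x P.≈ y → g x ≡ g y) →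
            (∀ y → (∃[ x ] to x P.≈ y) ⊎ g y ≡ 0ℤ) → ∑ Q.elements (g ∘ to) ≡ ∑ P.elements g
  ∑-image = ∑-reindex Q.decSetoid P.decSetoid Q.enumerates Q.unique P.enumerates P.unique
              to to-cong to-injective

  -- The value μ(0̂, x) depends only on the elements below x. By `down-full` those below `to x` are
  -- all images, so both sides obey the same recursion. This serves isomorphisms as well as the
  -- inclusion of P≤x.
  μ₀-embedding : ∀ x → Q.μ₀ x ≡ P.μ₀ (to x)
  μ₀-embedding x = go x (<-wellFounded (Q.rk x))
    where
    open ≡-Reasoning
    go : ∀ x → Acc ℕ._<_ (Q.rk x) → Q.μ₀ x ≡ P.μ₀ (to x)
    go x (acc rec) with x Q.≟ Q.0̂
    ... | yes x≈0̂ = trans (Q.μ₀-0̂ x≈0̂) (sym (P.μ₀-0̂ (P.Eq.trans (to-cong x≈0̂) to-0̂)))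
    ... | no  x≉0̂ = begin
      Q.μ₀ x
        ≡⟨ Q.μ₀-rec x≉0̂ ⟩
      ℤ.- ∑ Q.elements (λ z → when (z Q.<? x) (Q.μ₀ z))
        ≡⟨ cong ℤ.-_ (∑-cong Q.elements (λ z → when-cong (z Q.<? x) (to z P.<? to x)
             to-mono-< to-reflects-< (λ z<x → go z (rec (Q.rk-mono-< z<x))))) ⟩
      ℤ.- ∑ Q.elements (λ z → below (to z))
        ≡⟨ cong ℤ.-_ (∑-image below below-cong support) ⟩
      ℤ.- ∑ P.elements below
        ≡⟨ P.μ₀-rec (λ tox≈0̂ → x≉0̂ (to-injective (P.Eq.trans tox≈0̂ (P.Eq.sym to-0̂)))) ⟨
      P.μ₀ (to x) ∎
      where
      below : P.Carrier → ℤ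
      below w = when (w P.<? to x) (P.μ₀ w)

      below-cong : ∀ {v w} → v P.≈ w → below v ≡ below w
      below-cong {v} {w} v≈w = when-cong (v P.<? to x) (w P.<? to x)
        (P.<-respˡ-≈ v≈w) (P.<-respˡ-≈ (P.Eq.sym v≈w)) (λ _ → P.μ₀-cong v≈w)

      support : ∀ w → (∃[ z ] to z P.≈ w) ⊎ below w ≡ 0ℤ
      support w = by-cases (w P.<? to x)
        where
        by-cases : Dec (w P.< to x) → _
        by-cases (yes w<tox) = inj₁ (down-full (proj₁ w<tox))
        by-cases (no w≮tox)  = inj₂ (when-no (w P.<? to x) w≮tox)

record Isomorphism (Q P : RankedPoset) : Set where
  private
    module Q = RankedPoset Q
    module P = RankedPoset P
  field
    to         : Q.Carrier → P.Carrier
    monotone   : ∀ {x y} → x Q.≤ y → to x P.≤ to y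
    reflects   : ∀ {x y} → to x P.≤ to y → x Q.≤ y
    surjective : ∀ y → ∃[ x ] to x P.≈ y
    to-rk      : ∀ x → P.rk (to x) ≡ Q.rk x

  downEmbedding : DownEmbedding Q P
  downEmbedding = record
    { to = to ; monotone = monotone ; reflects = reflects ; down-full = λ {_} {y} _ → surjective y }

-- The characteristic polynomial

module _ (P : RankedPoset) where
  open RankedPoset P
  open RankedPosetProperties P

  coeff-χ : ∀ n → coeff (χ P) n ≡ ∑ elements (λ x → when (rank P ∸ rk x ℕₚ.≟ n) (μ₀ x))
  coeff-χ n = trans (coeff-∑ elements (λ x → monomial (μ₀ x) (rank P ∸ rk x)) n)
    (∑-cong elements (λ x → coeff-monomial (μ₀ x) (rank P ∸ rk x) n))

  coeff-χ-0 : coeff (χ P) 0 ≡ ∑ elements (λ x → when (rk x ℕₚ.≟ rank P) (μ₀ x))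
  coeff-χ-0 = trans (coeff-χ 0) (∑-cong elements (λ x →
    when-cong (rank P ∸ rk x ℕₚ.≟ 0) (rk x ℕₚ.≟ rank P)
      (λ eq → ℕₚ.≤-antisym (rk≤rank x) (ℕₚ.m∸n≡0⇒m≤n eq))
      (λ eq → trans (cong (rank P ∸_) eq) (ℕₚ.n∸n≡0 (rank P))) (λ _ → refl)))

  -- The exponent `rank P` is reached only in rank zero, hence only at `0̂`, where `μ₀` is 1.
  χ-monic : Monic (rank P) (χ P)
  χ-monic = record
    { leading = trans (coeff-χ (rank P)) (trans
        (∑-cong elements (λ x → when-cong (rank P ∸ rk x ℕₚ.≟ rank P) (x ≟ 0̂) (rk≡0⇒≈0̂ ∘ minimal x)
          (λ x≈0̂ → cong (rank P ∸_) (trans (rk-cong x≈0̂) rk-0̂)) (λ _ → refl)))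
        (trans (∑-δ 0̂ μ₀ μ₀-cong) (μ₀-0̂ Eq.refl)))
    ; above = λ {n} rank<n → trans (coeff-χ n) (∑-zero elements (λ x →
        when-no (rank P ∸ rk x ℕₚ.≟ n) (λ eq → ℕₚ.<⇒≱ rank<n (subst (ℕ._≤ rank P) eq (ℕₚ.m∸n≤m (rank P) (rk x))))))
    }
    where
    minimal : ∀ x → rank P ∸ rk x ≡ rank P → rk x ≡ 0
    minimal x eq = ℕₚ.+-cancelˡ-≡ (rank P) (rk x) 0 (trans
      (trans (cong (ℕ._+ rk x) (sym eq)) (ℕₚ.m∸n+n≡m (rk≤rank x))) (sym (ℕₚ.+-identityʳ (rank P))))

  μ₀-atom : ∀ {a} → Atom P a → μ₀ a ≡ -1ℤ
  μ₀-atom {a} rka≡1 = trans (μ₀-rec a≉0̂) (cong ℤ.-_ (trans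
    (∑-cong elements (λ z → when-cong (z <? a) (z ≟ 0̂)
      (λ z<a → rk≡0⇒≈0̂ (ℕₚ.n<1⇒n≡0 (subst (rk z ℕ.<_) rka≡1 (rk-mono-< z<a))))
      (λ z≈0̂ → <-respˡ-≈ (Eq.sym z≈0̂) (≉0̂⇒0̂< a≉0̂)) (λ _ → refl)))
    (trans (∑-δ 0̂ μ₀ μ₀-cong) (μ₀-0̂ Eq.refl))))
    where
    a≉0̂ : ¬ a ≈ 0̂
    a≉0̂ a≈0̂ = ℕₚ.1+n≢0 (trans (sym rka≡1) (trans (rk-cong a≈0̂) rk-0̂))

  -- Only atoms contribute, each with -1. In rank zero the prepended `0ℤ` is right too, as there are
  -- no atoms.
  χ-subleading : coeff (0ℤ ∷ χ P) (rank P) ≡ ℤ.- (+ length (atoms P))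
  χ-subleading = trans (by-rank (rank P) refl) (trans
    (sym (∑-filter (λ x → rk x ℕₚ.≟ 1) elements (λ _ → -1ℤ)))
    (trans (∑-neg (atoms P) (λ _ → 1ℤ)) (cong ℤ.-_ (∑-1≡length (atoms P)))))
    where
    by-rank : ∀ r → rank P ≡ r → coeff (0ℤ ∷ χ P) r ≡ ∑ elements (λ x → when (rk x ℕₚ.≟ 1) -1ℤ)
    by-rank zero    eq = sym (∑-zero elements (λ x → when-no (rk x ℕₚ.≟ 1)
      (λ rkx≡1 → ℕₚ.n≮0 (subst₂ ℕ._≤_ rkx≡1 eq (rk≤rank x)))))
    by-rank (suc n) eq = trans (coeff-χ n) (∑-cong elements (λ x →
      when-cong (rank P ∸ rk x ℕₚ.≟ n) (rk x ℕₚ.≟ 1) (to x) (from x) (μ₀-atom ∘ to x)))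
      where
      to : ∀ x → rank P ∸ rk x ≡ n → rk x ≡ 1
      to x e = ℕₚ.+-cancelˡ-≡ n (rk x) 1 (trans (cong (ℕ._+ rk x) (sym e))
        (trans (ℕₚ.m∸n+n≡m (rk≤rank x)) (trans eq (ℕₚ.+-comm 1 n))))
      from : ∀ x → rk x ≡ 1 → rank P ∸ rk x ≡ n
      from x e = cong₂ _∸_ eq e

χ-isomorphism : ∀ {Q P} → Isomorphism Q P → χ Q ≈ₚ χ P
χ-isomorphism {Q} {P} i n = begin
  coeff (χ Q) n
    ≡⟨ coeff-χ Q n ⟩
  ∑ Q.elements (λ x → when (rank Q ∸ Q.rk x ℕₚ.≟ n) (Q.μ₀ x))
    ≡⟨ ∑-cong Q.elements (λ x → cong₂ (λ k → when (k ℕₚ.≟ n))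
         (cong₂ _∸_ rank-eq (sym (to-rk x))) (μ₀-embedding downEmbedding x)) ⟩
  ∑ Q.elements (term ∘ to)
    ≡⟨ ∑-image downEmbedding term term-cong (inj₁ ∘ surjective) ⟩
  ∑ P.elements term
    ≡⟨ coeff-χ P n ⟨
  coeff (χ P) n ∎
  where
  open ≡-Reasoning
  open Isomorphism i
  module Q where
    open RankedPoset Q public
    open RankedPosetProperties Q public
  module P where
    open RankedPoset P public
    open RankedPosetProperties P public

  term : P.Carrier → ℤ
  term y = when (rank P ∸ P.rk y ℕₚ.≟ n) (P.μ₀ y)

  term-cong : ∀ {x y} → x P.≈ y → term x ≡ term y
  term-cong x≈y = cong₂ (λ k → when (k ℕₚ.≟ n)) (cong (rank P ∸_) (P.rk-cong x≈y)) (P.μ₀-cong x≈y)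

  rank-eq : rank Q ≡ rank P
  rank-eq =
    let (m , _ , m-max) = Q.maximal-above Q.0̂
        to-m-max : P.Maximal (to m)
        to-m-max = λ y tom≤y → let (x , tox≈y) = surjective y in
          P.Eq.trans (P.Eq.sym tox≈y) (DownEmbedding.to-cong downEmbedding
            (m-max x (reflects (P.≤-trans tom≤y (P.reflexive (P.Eq.sym tox≈y))))))
    in trans (Q.rank≡rk-maximal m-max) (trans (sym (to-rk m)) (sym (P.rank≡rk-maximal to-m-max)))

-- Geometric lattices

module GeometricLattice (L : RankedPoset) (geo : IsGeometricLattice L) where
  open RankedPoset L
  open RankedPosetProperties L
  open IsGeometricLattice geo
  open IsLattice isLattice using (x≤x∨y; y≤x∨y; ∨-least)

  ∨-congˡ : ∀ {x y} a → x ≈ y → x ∨ a ≈ y ∨ a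
  ∨-congˡ a x≈y = antisym (below x≈y) (below (Eq.sym x≈y))
    where
    below : ∀ {x y} → x ≈ y → x ∨ a ≤ y ∨ a
    below x≈y = ∨-least (≤-trans (reflexive x≈y) (x≤x∨y _ _)) (y≤x∨y _ _)

  ≤⇒∨≈ : ∀ {x a} → a ≤ x → x ∨ a ≈ x
  ≤⇒∨≈ a≤x = antisym (∨-least ≤-refl a≤x) (x≤x∨y _ _)

  ⋖-∨ : ∀ {x a} → Atom L a → ¬ a ≤ x → x ⋖ x ∨ a
  ⋖-∨ {x} {a} atom a≰x = Equivalence.from (geometric x (x ∨ a)) (a , atom , a≰x , Eq.refl)

  atom≉0̂ : ∀ {a} → Atom L a → ¬ a ≈ 0̂
  atom≉0̂ atom a≈0̂ = ℕₚ.1+n≢0 (trans (sym atom) (trans (rk-cong a≈0̂) rk-0̂))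

  -- Take x ≤ y maximal among the elements not above a.  If x ∨ a were below y,
  -- an atom b with x ∨ a ⋖ (x ∨ a) ∨ b ≤ y would give the larger element x ∨ b.
  avoiding-coatom : ∀ {a y} → Atom L a → a ≤ y → ∃[ x ] y ≈ x ∨ a × ¬ a ≤ x
  avoiding-coatom {a} {y} atom a≤y =
    go 0̂ (0̂-minimum y) (λ a≤0̂ → atom≉0̂ atom (0̂-minimal a a≤0̂)) (<-wellFounded (rk y ∸ rk 0̂))
    where
    go : ∀ x → x ≤ y → ¬ a ≤ x → Acc ℕ._<_ (rk y ∸ rk x) → ∃[ x ] y ≈ x ∨ a × ¬ a ≤ x
    go x x≤y a≰x (acc rec) with y ≟ x ∨ a
    ... | yes y≈x∨a = x , y≈x∨a , a≰x
    ... | no  y≉x∨a = go (x ∨ b) x∨b≤y a≰x∨b (rec (ℕₚ.∸-monoʳ-< (rk-mono-< (proj₁ x⋖x∨b)) (rk-mono-≤ x∨b≤y)))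
      where
      cover : ∃[ w ] x ∨ a ⋖ w × w ≤ y
      cover = cover-below (∨-least x≤y a≤y , λ e → y≉x∨a (Eq.sym e))
      w : Carrier
      w = proj₁ cover
      geo-atom : ∃[ b ] Atom L b × ¬ b ≤ x ∨ a × w ≈ (x ∨ a) ∨ b
      geo-atom = Equivalence.to (geometric (x ∨ a) w) (proj₁ (proj₂ cover))
      b : Carrier
      b = proj₁ geo-atom
      b≰x∨a : ¬ b ≤ x ∨ a
      b≰x∨a = proj₁ (proj₂ (proj₂ geo-atom))
      b≤y : b ≤ y
      b≤y = ≤-trans (y≤x∨y (x ∨ a) b)
              (≤-trans (reflexive (Eq.sym (proj₂ (proj₂ (proj₂ geo-atom))))) (proj₂ (proj₂ cover)))
      x∨b≤y : x ∨ b ≤ y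
      x∨b≤y = ∨-least x≤y b≤y
      x⋖x∨b : x ⋖ x ∨ b
      x⋖x∨b = ⋖-∨ (proj₁ (proj₂ geo-atom)) (λ b≤x → b≰x∨a (≤-trans b≤x (x≤x∨y x a)))
      -- If `a ≤ x ∨ b`, then `x ∨ a ≤ x ∨ b`. Both cover `x`, so their ranks agree and they
      -- coincide, which puts `b` below `x ∨ a`.
      a≰x∨b : ¬ a ≤ x ∨ b
      a≰x∨b a≤x∨b = b≰x∨a (≤-trans (y≤x∨y x b) (reflexive (Eq.sym x∨a≈x∨b)))
        where
        x∨a≈x∨b : x ∨ a ≈ x ∨ b
        x∨a≈x∨b = ≈-by-rank (∨-least (x≤x∨y x b) a≤x∨b)
          (ℕₚ.≤-reflexive (trans (rk-cover x⋖x∨b) (sym (rk-cover (⋖-∨ atom a≰x)))))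

  module _ {a : Carrier} (atom : Atom L a) where

    ∑-joining : Carrier → ℤ
    ∑-joining w = ∑ elements (λ x → when (w ≟ x ∨ a) (μ₀ x))

    -- Grouping the vanishing sum of μ₀ over x ≤ z by the value w of x ∨ a leaves
    -- only w = z, since the groups with w < z vanish by induction.
    weisner : ∀ {z} → a ≤ z → ∑-joining z ≡ 0ℤ
    weisner {z} a≤z = go z a≤z (<-wellFounded (rk z))
      where
      open ≡-Reasoning
      go : ∀ z → a ≤ z → Acc ℕ._<_ (rk z) → ∑-joining z ≡ 0ℤ
      go z a≤z (acc rec) = begin
        ∑-joining z
          ≡⟨ ∑-δ z ∑-joining (λ {x} x≈z → ∑-cong elements (λ y → when-cong (x ≟ y ∨ a) (z ≟ y ∨ a)
               (Eq.trans (Eq.sym x≈z)) (Eq.trans x≈z) (λ _ → refl))) ⟨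
        ∑ elements (λ w → when (w ≟ z) (∑-joining w))
          ≡⟨ ∑-cong elements (λ w → by-cases w (w ≟ z) (w ≤? z)) ⟩
        ∑ elements (λ w → ∑ elements (λ x → when (w ≟ x ∨ a) (when (w ≤? z) (μ₀ x))))
          ≡⟨ ∑-swap elements elements (λ x w → when (w ≟ x ∨ a) (when (w ≤? z) (μ₀ x))) ⟨
        ∑ elements (λ x → ∑ elements (λ w → when (w ≟ x ∨ a) (when (w ≤? z) (μ₀ x))))
          ≡⟨ ∑-cong elements (λ x → ∑-δ (x ∨ a) (λ w → when (w ≤? z) (μ₀ x))
               (λ {w} w≈ → when-cong (w ≤? z) (x ∨ a ≤? z)
                 (≤-trans (reflexive (Eq.sym w≈))) (≤-trans (reflexive w≈)) (λ _ → refl))) ⟩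
        ∑ elements (λ x → when (x ∨ a ≤? z) (μ₀ x))
          ≡⟨ ∑-cong elements (λ x → when-cong (x ∨ a ≤? z) (x ≤? z)
               (≤-trans (x≤x∨y x a)) (λ x≤z → ∨-least x≤z a≤z) (λ _ → refl)) ⟩
        ∑ elements (λ x → when (x ≤? z) (μ₀ x))
          ≡⟨ ∑-μ₀-below z≉0̂ ⟩
        0ℤ ∎
        where
        z≉0̂ : ¬ z ≈ 0̂
        z≉0̂ z≈0̂ = atom≉0̂ atom (0̂-minimal a (≤-trans a≤z (reflexive z≈0̂)))

        ∑-joining≡0 : ∀ w → w < z → Dec (a ≤ w) → ∑-joining w ≡ 0ℤ
        ∑-joining≡0 w w<z (yes a≤w) = go w a≤w (rec (rk-mono-< w<z))
        ∑-joining≡0 w w<z (no a≰w)  = ∑-zero elements (λ x → when-no (w ≟ x ∨ a)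
          (λ w≈x∨a → a≰w (≤-trans (y≤x∨y x a) (reflexive (Eq.sym w≈x∨a)))))

        by-cases : ∀ w → Dec (w ≈ z) → Dec (w ≤ z) →
          when (w ≟ z) (∑-joining w) ≡ ∑ elements (λ x → when (w ≟ x ∨ a) (when (w ≤? z) (μ₀ x)))
        by-cases w (yes w≈z) _ = trans (when-yes (w ≟ z) w≈z)
          (∑-cong elements (λ x → cong (when (w ≟ x ∨ a)) (sym (when-yes (w ≤? z) (reflexive w≈z)))))
        by-cases w (no w≉z) (yes w≤z) = trans (when-no (w ≟ z) w≉z) (trans
          (sym (∑-joining≡0 w (w≤z , w≉z) (a ≤? w)))
          (∑-cong elements (λ x → cong (when (w ≟ x ∨ a)) (sym (when-yes (w ≤? z) w≤z)))))
        by-cases w (no w≉z) (no w≰z) = trans (when-no (w ≟ z) w≉z) (sym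
          (∑-zero elements (λ x → trans (cong (when (w ≟ x ∨ a)) (when-no (w ≤? z) w≰z)) (when-0 (w ≟ x ∨ a)))))

  -- By Weisner's theorem, μ₀ y is minus the sum of μ₀ x over the coatoms x of
  -- [0̂, y] that are not above a chosen atom.
  μ₀-alternates : ∀ y → 0ℤ ℤ.< -1ℤ ℤ.^ rk y ℤ.* μ₀ y
  μ₀-alternates y = go y (<-wellFounded (rk y))
    where
    open ≡-Reasoning
    go : ∀ y → Acc ℕ._<_ (rk y) → 0ℤ ℤ.< -1ℤ ℤ.^ rk y ℤ.* μ₀ y
    go y (acc rec) with y ≟ 0̂
    ... | yes y≈0̂ = subst (0ℤ ℤ.<_) (sym (cong₂ (λ n z → -1ℤ ℤ.^ n ℤ.* z) (trans (rk-cong y≈0̂) rk-0̂) (μ₀-0̂ y≈0̂)))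
                      (ℤ.+<+ (ℕ.s≤s ℕ.z≤n))
    ... | no  y≉0̂ = subst (0ℤ ℤ.<_) ∑-term (∑-pos term-cong (λ x → term-nonNeg x (x ≟ y) (y ≟ x ∨ a))
                      x₀ (term-pos y≈x₀∨a a≰x₀))
      where
      a : Carrier
      a = proj₁ (atom-below y≉0̂)
      a-atom : Atom L a
      a-atom = proj₁ (proj₂ (atom-below y≉0̂))
      a≤y : a ≤ y
      a≤y = proj₂ (proj₂ (atom-below y≉0̂))
      x₀ : Carrier
      x₀ = proj₁ (avoiding-coatom a-atom a≤y)
      y≈x₀∨a : y ≈ x₀ ∨ a
      y≈x₀∨a = proj₁ (proj₂ (avoiding-coatom a-atom a≤y))
      a≰x₀ : ¬ a ≤ x₀
      a≰x₀ = proj₂ (proj₂ (avoiding-coatom a-atom a≤y))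

      s : ℤ
      s = -1ℤ ℤ.^ rk y

      -- The second part sums to zero by Weisner's theorem, so subtracting it leaves the total
      -- `s * μ₀ y`. It makes all terms nonnegative: at `x ≈ y` the two parts cancel because
      -- `y ∨ a ≈ y`, and any other `x` with `y ≈ x ∨ a` is not above `a`, has rank one less than
      -- `y`, and contributes its own signed Möbius value, positive by induction. The element `x₀`
      -- is one of these, so the total is strictly positive.
      term : Carrier → ℤ
      term x = when (x ≟ y) (s ℤ.* μ₀ x) ℤ.- when (y ≟ x ∨ a) (s ℤ.* μ₀ x)

      term-cong : ∀ {u v} → u ≈ v → term u ≡ term v
      term-cong {u} {v} u≈v = cong₂ ℤ._-_
        (when-cong (u ≟ y) (v ≟ y) (Eq.trans (Eq.sym u≈v)) (Eq.trans u≈v) (λ _ → cong (ℤ._*_ s) (μ₀-cong u≈v)))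
        (when-cong (y ≟ u ∨ a) (y ≟ v ∨ a) (λ e → Eq.trans e (∨-congˡ a u≈v))
          (λ e → Eq.trans e (∨-congˡ a (Eq.sym u≈v))) (λ _ → cong (ℤ._*_ s) (μ₀-cong u≈v)))

      ∑-term : ∑ elements term ≡ s ℤ.* μ₀ y
      ∑-term = begin
        ∑ elements term
          ≡⟨ ∑-+ elements (λ x → when (x ≟ y) (s ℤ.* μ₀ x)) (λ x → ℤ.- when (y ≟ x ∨ a) (s ℤ.* μ₀ x)) ⟩
        ∑ elements (λ x → when (x ≟ y) (s ℤ.* μ₀ x)) ℤ.+ ∑ elements (λ x → ℤ.- when (y ≟ x ∨ a) (s ℤ.* μ₀ x))
          ≡⟨ cong₂ ℤ._+_ (∑-δ y (λ x → s ℤ.* μ₀ x) (cong (ℤ._*_ s) ∘ μ₀-cong))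
               (∑-neg elements (λ x → when (y ≟ x ∨ a) (s ℤ.* μ₀ x))) ⟩
        s ℤ.* μ₀ y ℤ.- ∑ elements (λ x → when (y ≟ x ∨ a) (s ℤ.* μ₀ x))
          ≡⟨ cong (λ z → s ℤ.* μ₀ y ℤ.- z) (∑-cong elements (λ x → when-* (y ≟ x ∨ a) s (μ₀ x))) ⟨
        s ℤ.* μ₀ y ℤ.- ∑ elements (λ x → s ℤ.* when (y ≟ x ∨ a) (μ₀ x))
          ≡⟨ cong (λ z → s ℤ.* μ₀ y ℤ.- z) (trans (∑-*ˡ elements s (λ x → when (y ≟ x ∨ a) (μ₀ x)))
               (trans (cong (ℤ._*_ s) (weisner a-atom a≤y)) (ℤₚ.*-zeroʳ s))) ⟩
        s ℤ.* μ₀ y ℤ.- 0ℤ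
          ≡⟨ ℤₚ.+-identityʳ _ ⟩
        s ℤ.* μ₀ y ∎

      term-pos : ∀ {x} → y ≈ x ∨ a → ¬ a ≤ x → 0ℤ ℤ.< term x
      term-pos {x} y≈x∨a a≰x = subst (0ℤ ℤ.<_) (sym (trans
        (cong₂ ℤ._-_ (when-no (x ≟ y) (λ x≈y → a≰x (≤-trans a≤y (reflexive (Eq.sym x≈y)))))
                     (when-yes (y ≟ x ∨ a) y≈x∨a))
        (trans (cong (λ n → 0ℤ ℤ.- -1ℤ ℤ.^ n ℤ.* μ₀ x) rky) (lemma (-1ℤ ℤ.^ rk x) (μ₀ x)))))
        (go x (rec (subst (rk x ℕ.<_) (sym rky) ℕₚ.≤-refl)))
        where
        rky : rk y ≡ suc (rk x)
        rky = trans (rk-cong y≈x∨a) (rk-cover (⋖-∨ a-atom a≰x))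
        lemma : ∀ p z → 0ℤ ℤ.- (-1ℤ ℤ.* p) ℤ.* z ≡ p ℤ.* z
        lemma = solve-∀

      term-nonNeg : ∀ x → Dec (x ≈ y) → Dec (y ≈ x ∨ a) → 0ℤ ℤ.≤ term x
      term-nonNeg x (yes x≈y) _ = ℤₚ.≤-reflexive (sym (trans
        (cong₂ ℤ._-_ (when-yes (x ≟ y) x≈y)
          (when-yes (y ≟ x ∨ a) (Eq.trans (Eq.sym x≈y)
            (Eq.sym (≤⇒∨≈ (≤-trans a≤y (reflexive (Eq.sym x≈y))))))))
        (ℤₚ.+-inverseʳ (s ℤ.* μ₀ x))))
      term-nonNeg x (no x≉y) (yes y≈x∨a) = ℤₚ.<⇒≤ (term-pos y≈x∨a
        (λ a≤x → x≉y (Eq.sym (Eq.trans y≈x∨a (≤⇒∨≈ a≤x)))))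
      term-nonNeg x (no x≉y) (no y≉x∨a) = ℤₚ.≤-reflexive (sym
        (cong₂ ℤ._-_ (when-no (x ≟ y) x≉y) (when-no (y ≟ x ∨ a) y≉x∨a)))

-- Signs in locally geometric posets

lower-embedding : ∀ P x → DownEmbedding (lower P x) P
lower-embedding P x = record
  { to        = proj₁
  ; monotone  = id
  ; reflects  = id
  ; down-full = λ {z} {y} y≤z → (y , RankedPoset.≤-trans P y≤z (proj₂ z)) , RankedPoset.Eq.refl P
  }

module _ (P : RankedPoset) (geo : LocallyGeometric P) where
  open RankedPoset P
  open RankedPosetProperties P

  private
    alternates : ∀ x → 0ℤ ℤ.< -1ℤ ℤ.^ rk x ℤ.* μ₀ x
    alternates x = subst (λ z → 0ℤ ℤ.< -1ℤ ℤ.^ rk x ℤ.* z) (μ₀-embedding (lower-embedding P x) (x , ≤-refl))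
      (GeometricLattice.μ₀-alternates (lower P x) (geo x) (x , ≤-refl))

  -- The elements of full rank all contribute with the same sign, so nothing cancels, and `∃-rank`
  -- shows that there is at least one.
  χ-constant-alternates : 0ℤ ℤ.< -1ℤ ℤ.^ rank P ℤ.* coeff (χ P) 0
  χ-constant-alternates = subst (0ℤ ℤ.<_)
    (trans (∑-cong elements (λ x → sym (when-* (rk x ℕₚ.≟ rank P) s (μ₀ x))))
      (trans (∑-*ˡ elements s (λ x → when (rk x ℕₚ.≟ rank P) (μ₀ x))) (cong (ℤ._*_ s) (sym (coeff-χ-0 P)))))
    (∑-pos {term} term-cong (λ x → nonNeg x (rk x ℕₚ.≟ rank P)) (proj₁ ∃-rank) (pos (proj₁ ∃-rank) (proj₂ ∃-rank)))
    where
    s : ℤ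
    s = -1ℤ ℤ.^ rank P

    term : Carrier → ℤ
    term x = when (rk x ℕₚ.≟ rank P) (s ℤ.* μ₀ x)

    term-cong : ∀ {x y} → x ≈ y → term x ≡ term y
    term-cong x≈y = cong₂ (λ k z → when (k ℕₚ.≟ rank P) (s ℤ.* z)) (rk-cong x≈y) (μ₀-cong x≈y)

    pos : ∀ x → rk x ≡ rank P → 0ℤ ℤ.< term x
    pos x eq = subst (0ℤ ℤ.<_) (sym (trans (when-yes (rk x ℕₚ.≟ rank P) eq)
      (cong (λ n → -1ℤ ℤ.^ n ℤ.* μ₀ x) (sym eq)))) (alternates x)

    nonNeg : ∀ x → Dec (rk x ≡ rank P) → 0ℤ ℤ.≤ term x
    nonNeg x (yes eq) = ℤₚ.<⇒≤ (pos x eq)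
    nonNeg x (no neq) = ℤₚ.≤-reflexive (sym (when-no (rk x ℕₚ.≟ rank P) neq))

-- Local geometricity of P≥a

module _ (P : RankedPoset) where
  open RankedPoset P

  -- The interval [a, y] is closed under the joins and meets of [0̂, y], and covers agree because
  -- the two rank functions differ by the constant `rk a`. An atom of [a, y] is traded for an atom
  -- of [0̂, y] through b = a ∨ c; as `a ≤ u`, joining `u` with b or with c gives the same element.
  locallyGeometric-upper : LocallyGeometric P → ∀ a → LocallyGeometric (upper P a)
  locallyGeometric-upper geo a (y , a≤y) = record
    { _∨_       = join
    ; _∧_       = meet
    ; isLattice = record
      { isPartialOrder = DecPoset.isPartialOrder (RankedPoset.decPoset I)
      ; supremum = λ u v → L.x≤x∨y (↓ u) (↓ v) , L.y≤x∨y (↓ u) (↓ v) , λ w u≤w v≤w → L.∨-least {↓ u} {↓ v} {↓ w} u≤w v≤w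
      ; infimum  = λ u v → L.x∧y≤x (↓ u) (↓ v) , L.x∧y≤y (↓ u) (↓ v) , λ w w≤u w≤v → L.∧-greatest {↓ w} {↓ u} {↓ v} w≤u w≤v
      }
    ; geometric = λ u v → mk⇔ (cover⇒join u v) (join⇒cover u v)
    }
    where
    I : RankedPoset
    I = lower (upper P a) (y , a≤y)

    module I where
      open RankedPoset I public
      open RankedPosetProperties I public

    module L where
      open RankedPoset (lower P y) public
      open RankedPosetProperties (lower P y) public
      open IsGeometricLattice (geo y) public
      open IsLattice isLattice public using (x≤x∨y; y≤x∨y; ∨-least; x∧y≤x; x∧y≤y; ∧-greatest)
      open GeometricLattice (lower P y) (geo y) public using (⋖-∨)

    ↓ : I.Carrier → L.Carrier
    ↓ ((z , _) , z≤y) = z , z≤y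

    a′ : L.Carrier
    a′ = a , a≤y

    a′≤ : ∀ u → a′ L.≤ ↓ u
    a′≤ ((_ , a≤z) , _) = a≤z

    ↑ : ∀ z → a′ L.≤ z → I.Carrier
    ↑ (z , z≤y) a≤z = (z , a≤z) , z≤y

    join meet : I.Carrier → I.Carrier → I.Carrier
    join u v = ↑ (↓ u L.∨ ↓ v) (≤-trans (a′≤ u) (L.x≤x∨y (↓ u) (↓ v)))
    meet u v = ↑ (↓ u L.∧ ↓ v) (L.∧-greatest {a′} {↓ u} {↓ v} (a′≤ u) (a′≤ v))

    rk-↓ : ∀ u → L.rk (↓ u) ≡ rk a ℕ.+ I.rk u
    rk-↓ ((z , a≤z) , _) = sym (ℕₚ.m+[n∸m]≡n (rk-mono-≤ a≤z))

    ↓-⋖ : ∀ {u v} → u I.⋖ v → ↓ u L.⋖ ↓ v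
    ↓-⋖ {u} {v} u⋖v = L.≤∧rk-suc⇒⋖ {↓ u} {↓ v} (proj₁ (proj₁ u⋖v)) (begin
      L.rk (↓ v)              ≡⟨ rk-↓ v ⟩
      rk a ℕ.+ I.rk v         ≡⟨ cong (rk a ℕ.+_) (I.rk-cover {u} {v} u⋖v) ⟩
      rk a ℕ.+ suc (I.rk u)   ≡⟨ ℕₚ.+-suc (rk a) (I.rk u) ⟩
      suc (rk a ℕ.+ I.rk u)   ≡⟨ cong suc (rk-↓ u) ⟨
      suc (L.rk (↓ u))        ∎)
      where open ≡-Reasoning

    ↑-⋖ : ∀ {u v} → ↓ u L.⋖ ↓ v → u I.⋖ v
    ↑-⋖ {u} {v} u⋖v = I.≤∧rk-suc⇒⋖ {u} {v} (proj₁ (proj₁ u⋖v)) (ℕₚ.+-cancelˡ-≡ (rk a) (I.rk v) (suc (I.rk u)) (begin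
      rk a ℕ.+ I.rk v         ≡⟨ rk-↓ v ⟨
      L.rk (↓ v)              ≡⟨ L.rk-cover {↓ u} {↓ v} u⋖v ⟩
      suc (L.rk (↓ u))        ≡⟨ cong suc (rk-↓ u) ⟩
      suc (rk a ℕ.+ I.rk u)   ≡⟨ ℕₚ.+-suc (rk a) (I.rk u) ⟨
      rk a ℕ.+ suc (I.rk u)   ∎))
      where open ≡-Reasoning

    -- The lattice [0̂, y] supplies an atom `c` not below `u`, hence not below `a ≤ u`; so a ∨ c
    -- covers `a` and is an atom of [a, y].
    cover⇒join : ∀ u v → u I.⋖ v → ∃[ b ] Atom I b × ¬ b I.≤ u × v I.≈ join u b
    cover⇒join u v u⋖v = b , b-atom , c≰u ∘ ≤-trans (L.y≤x∨y a′ c) ,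
      antisym (≤-trans (reflexive v≈u∨c) (L.∨-least {↓ u} {c} {↓ u L.∨ (a′ L.∨ c)}
                 (L.x≤x∨y (↓ u) (a′ L.∨ c)) (≤-trans (L.y≤x∨y a′ c) (L.y≤x∨y (↓ u) (a′ L.∨ c)))))
              (L.∨-least {↓ u} {a′ L.∨ c} {↓ v} u≤v (L.∨-least {a′} {c} {↓ v} (a′≤ v)
                 (≤-trans (L.y≤x∨y (↓ u) c) (reflexive (Eq.sym v≈u∨c)))))
      where
      u≤v : ↓ u L.≤ ↓ v
      u≤v = proj₁ (proj₁ u⋖v)
      new-atom : ∃[ c ] Atom (lower P y) c × ¬ c L.≤ ↓ u × ↓ v L.≈ ↓ u L.∨ c
      new-atom = Equivalence.to (L.geometric (↓ u) (↓ v)) (↓-⋖ {u} {v} u⋖v)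
      c : L.Carrier
      c = proj₁ new-atom
      c≰u : ¬ c L.≤ ↓ u
      c≰u = proj₁ (proj₂ (proj₂ new-atom))
      v≈u∨c : ↓ v L.≈ ↓ u L.∨ c
      v≈u∨c = proj₂ (proj₂ (proj₂ new-atom))
      b : I.Carrier
      b = ↑ (a′ L.∨ c) (L.x≤x∨y a′ c)
      b-atom : Atom I b
      b-atom = trans (I.rk-cover {I.0̂} {b} (↑-⋖ {I.0̂} {b}
        (L.⋖-∨ {a′} {c} (proj₁ (proj₂ new-atom)) (λ c≤a → c≰u (≤-trans c≤a (a′≤ u))))))
        (cong suc I.rk-0̂)

    -- Since `b` covers `a`, it is a ∨ c for an atom `c` of [0̂, y]. With `c ≤ u`, also `b ≤ u`
    -- would follow.
    join⇒cover : ∀ u v → (∃[ b ] Atom I b × ¬ b I.≤ u × v I.≈ join u b) → u I.⋖ v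
    join⇒cover u v (b , b-atom , b≰u , v≈u∨b) = ↑-⋖ {u} {v}
      (Equivalence.from (L.geometric (↓ u) (↓ v)) (c , proj₁ (proj₂ new-atom) , c≰u , v≈u∨c))
      where
      a⋖b : a′ L.⋖ ↓ b
      a⋖b = ↓-⋖ {I.0̂} {b} (I.≤∧rk-suc⇒⋖ {I.0̂} {b} (I.0̂-minimum b) (trans b-atom (cong suc (sym I.rk-0̂))))
      new-atom : ∃[ c ] Atom (lower P y) c × ¬ c L.≤ a′ × ↓ b L.≈ a′ L.∨ c
      new-atom = Equivalence.to (L.geometric a′ (↓ b)) a⋖b
      c : L.Carrier
      c = proj₁ new-atom
      b≈a∨c : ↓ b L.≈ a′ L.∨ c
      b≈a∨c = proj₂ (proj₂ (proj₂ new-atom))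
      c≤b : c L.≤ ↓ b
      c≤b = ≤-trans (L.y≤x∨y a′ c) (reflexive (Eq.sym b≈a∨c))
      b≤ : ∀ w → a′ L.≤ w → c L.≤ w → ↓ b L.≤ w
      b≤ w a≤w c≤w = ≤-trans (reflexive b≈a∨c) (L.∨-least {a′} {c} {w} a≤w c≤w)
      c≰u : ¬ c L.≤ ↓ u
      c≰u c≤u = b≰u (b≤ (↓ u) (a′≤ u) c≤u)
      v≈u∨c : ↓ v L.≈ ↓ u L.∨ c
      v≈u∨c = antisym
        (≤-trans (reflexive v≈u∨b) (L.∨-least {↓ u} {↓ b} {↓ u L.∨ c} (L.x≤x∨y (↓ u) c)
          (b≤ (↓ u L.∨ c) (≤-trans (a′≤ u) (L.x≤x∨y (↓ u) c)) (L.y≤x∨y (↓ u) c))))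
        (≤-trans (L.∨-least {↓ u} {c} {join↓} (L.x≤x∨y (↓ u) (↓ b)) (≤-trans c≤b (L.y≤x∨y (↓ u) (↓ b))))
          (reflexive (Eq.sym v≈u∨b)))
        where
        join↓ : L.Carrier
        join↓ = ↓ u L.∨ ↓ b

-- Divisional chains

module _ (P : RankedPoset) where
  open RankedPoset P

  upper-0̂≅ : ∀ {x} → x ≈ 0̂ → Isomorphism (upper P x) P
  upper-0̂≅ {x} x≈0̂ = record
    { to         = proj₁
    ; monotone   = id
    ; reflects   = id
    ; surjective = λ y → (y , ≤-trans (reflexive x≈0̂) (0̂-minimum y)) , Eq.refl
    ; to-rk      = λ (y , _) → sym (cong (rk y ∸_) (trans (rk-cong x≈0̂) rk-0̂))
    }

  upper-upper≅ : ∀ {x} (y : RankedPoset.Carrier (upper P x)) →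
                 Isomorphism (upper (upper P x) y) (upper P (proj₁ y))
  upper-upper≅ {x} (y , x≤y) = record
    { to         = λ ((z , _) , y≤z) → z , y≤z
    ; monotone   = id
    ; reflects   = id
    ; surjective = λ (z , y≤z) → ((z , ≤-trans x≤y y≤z) , y≤z) , Eq.refl
    ; to-rk      = λ ((z , _) , _) → begin
        rk z ∸ rk y                     ≡⟨ cong (rk z ∸_) (ℕₚ.m+[n∸m]≡n (rk-mono-≤ x≤y)) ⟨
        rk z ∸ (rk x ℕ.+ (rk y ∸ rk x)) ≡⟨ ℕₚ.∸-+-assoc (rk z) (rk x) (rk y ∸ rk x) ⟨
        rk z ∸ rk x ∸ (rk y ∸ rk x)     ∎
    }
    where open ≡-Reasoning

χ-isomorphism⁻¹ : ∀ {Q P} → Isomorphism Q P → χ P ≈ₚ χ Q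
χ-isomorphism⁻¹ i n = sym (χ-isomorphism i n)

-- The length `r` is a separate argument so that the recursion can match on it: P≥a has rank one
-- less, and its chain is prolonged downwards by `0̂`.
divisional⇒chain : ∀ {P} → Divisional P → ∀ r → rank P ≡ r → ∃[ x ] IsDivisionalChain P {r} x
divisional⇒chain (point P all≈0̂) zero rank≡0 = (λ _ → 0̂) , record
  { starts     = Eq.refl
  ; increasing = λ ()
  ; ranks      = λ { fzero → rk-0̂ }
  ; divides    = λ ()
  }
  where open RankedPoset P
divisional⇒chain (point P all≈0̂) (suc r) rank≡1+r = contradiction
  (trans (sym rank≡1+r) (trans (sym rkm≡rank) (trans (rk-cong (all≈0̂ m)) rk-0̂))) ℕₚ.1+n≢0
  where
  open RankedPoset P
  open RankedPosetProperties P
  m = proj₁ ∃-rank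
  rkm≡rank = proj₂ ∃-rank
divisional⇒chain (step P geo a atom div χ∣χ) zero rank≡0 =
  contradiction (subst₂ ℕ._≤_ atom rank≡0 (RankedPosetProperties.rk≤rank P a)) λ ()
divisional⇒chain (step P geo a atom div χ∣χ) (suc r) rank≡1+r = x , record
  { starts     = Eq.refl
  ; increasing = increasing
  ; ranks      = ranks
  ; divides    = divides
  }
  where
  open RankedPoset P
  open RankedPosetProperties P
  U = upper P a

  tail : ∃[ y ] IsDivisionalChain U {r} y
  tail = divisional⇒chain div r (trans (rank-upper P a) (cong₂ _∸_ rank≡1+r atom))

  module Tail = IsDivisionalChain (proj₂ tail)

  y : Fin (suc r) → RankedPoset.Carrier U
  y = proj₁ tail

  x : Fin (suc (suc r)) → Carrier
  x fzero    = 0̂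
  x (fsuc i) = proj₁ (y i)

  ranks : ∀ i → rk (x i) ≡ toℕ i
  ranks fzero    = rk-0̂
  ranks (fsuc i) = begin
    rk (proj₁ (y i))                    ≡⟨ ℕₚ.m+[n∸m]≡n (rk-mono-≤ (proj₂ (y i))) ⟨
    rk a ℕ.+ (rk (proj₁ (y i)) ∸ rk a)  ≡⟨ cong₂ ℕ._+_ atom (Tail.ranks i) ⟩
    suc (toℕ i)                         ∎
    where open ≡-Reasoning

  increasing : ∀ i → x (inject₁ i) < x (fsuc i)
  increasing fzero    = ≉0̂⇒0̂< (λ y₀≈0̂ → ℕₚ.1+n≢0 (trans (sym (ranks (fsuc fzero))) (trans (rk-cong y₀≈0̂) rk-0̂)))
  increasing (fsuc i) = Tail.increasing i

  divides : ∀ i → χ (upper P (x (fsuc i))) ∣ₚ χ (upper P (x (inject₁ i)))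
  -- The chain of `U` starts at `y fzero`, which is only `≈` to `a`; so `U` is compared with
  -- `upper U (y fzero)` and that with `upper P (proj₁ (y fzero))`.
  divides fzero    = ∣ₚ-resp
    (λ n → trans (χ-isomorphism⁻¹ (upper-0̂≅ U Tail.starts) n) (χ-isomorphism (upper-upper≅ P (y fzero)) n))
    (χ-isomorphism⁻¹ (upper-0̂≅ P Eq.refl)) χ∣χ
  divides (fsuc i) = ∣ₚ-resp (χ-isomorphism (upper-upper≅ P (y (fsuc i))))
    (χ-isomorphism (upper-upper≅ P (y (inject₁ i)))) (Tail.divides i)

module _ (P : RankedPoset) where
  open RankedPoset P

  increasing⇒minimum : ∀ {r} (x : Fin (suc r) → Carrier) → (∀ i → x (inject₁ i) < x (fsuc i)) →
                       ∀ i → x fzero ≤ x i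
  increasing⇒minimum         x inc fzero    = ≤-refl
  increasing⇒minimum {suc r} x inc (fsuc i) =
    ≤-trans (proj₁ (inc fzero)) (increasing⇒minimum (x ∘ fsuc) (inc ∘ fsuc) i)

chain⇒divisional : ∀ r P → rank P ≡ r → LocallyGeometric P →
                   (x : Fin (suc r) → RankedPoset.Carrier P) → IsDivisionalChain P x → Divisional P
chain⇒divisional zero P rank≡0 geo x chain =
  point P (λ y → rk≡0⇒≈0̂ (ℕₚ.n≤0⇒n≡0 (subst (RankedPoset.rk P y ℕ.≤_) rank≡0 (rk≤rank y))))
  where open RankedPosetProperties P
chain⇒divisional (suc r) P rank≡1+r geo x chain = step P geo a (ranks (fsuc fzero))
  (chain⇒divisional r (upper P a)
    (trans (rank-upper P a) (cong₂ _∸_ rank≡1+r (ranks (fsuc fzero))))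
    (locallyGeometric-upper P geo a) y record
      { starts     = Eq.refl
      ; increasing = increasing ∘ fsuc
      ; ranks      = λ i → cong₂ _∸_ (ranks (fsuc i)) (ranks (fsuc fzero))
      ; divides    = λ i → ∣ₚ-resp (χ-isomorphism⁻¹ (upper-upper≅ P (y (fsuc i))))
                                   (χ-isomorphism⁻¹ (upper-upper≅ P (y (inject₁ i)))) (divides (fsuc i))
      })
  (∣ₚ-resp (λ _ → refl) (χ-isomorphism (upper-0̂≅ P starts)) (divides fzero))
  where
  open RankedPoset P
  open IsDivisionalChain chain

  a : Carrier
  a = x (fsuc fzero)

  y : Fin (suc r) → RankedPoset.Carrier (upper P a)
  y i = x (fsuc i) , increasing⇒minimum P (x ∘ fsuc) (increasing ∘ fsuc) i

-- Factorisation along a chain and the exponents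

module _ (Q R : RankedPoset) (rank≡ : rank Q ≡ suc (rank R)) (χ∣χ : χ R ∣ₚ χ Q) where

  atomDifference : ℤ
  atomDifference = + length (atoms Q) ℤ.- + length (atoms R)

  χ-linear-cofactor : χ Q ≈ₚ (t- atomDifference) *ₚ χ R
  χ-linear-cofactor = subst (λ z → χ Q ≈ₚ (t- z) *ₚ χ R) root
    (monic-cofactor (χ-monic R) (subst (λ n → Monic n (χ Q)) rank≡ (χ-monic Q)) χ∣χ)
    where
    root : coeff (0ℤ ∷ χ R) (rank R) ℤ.- coeff (χ Q) (rank R) ≡ atomDifference
    -- By definition `coeff (χ Q) (rank R)` is `coeff (0ℤ ∷ χ Q) (suc (rank R))`, and the index is
    -- `rank Q`.
    root = trans (cong₂ ℤ._-_ (χ-subleading R)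
        (trans (cong (coeff (0ℤ ∷ χ Q)) (sym rank≡)) (χ-subleading Q)))
      (lemma (+ length (atoms R)) (+ length (atoms Q)))
      where
      lemma : ∀ u v → ℤ.- u ℤ.- ℤ.- v ≡ v ℤ.- u
      lemma = solve-∀

  -- The constant coefficients of χ Q and χ R have opposite signs.
  atomDifference-positive : LocallyGeometric Q → LocallyGeometric R → 0ℤ ℤ.< atomDifference
  atomDifference-positive geoQ geoR = ℤₚ.*-cancelʳ-<-nonNeg cR
    {{ℤ.nonNegative (ℤₚ.<⇒≤ (χ-constant-alternates R geoR))}}
    (subst (0ℤ ℤ.<_) cQ≡ (χ-constant-alternates Q geoQ))
    where
    cR : ℤ
    cR = -1ℤ ℤ.^ rank R ℤ.* coeff (χ R) 0
    lemma : ∀ p u z → (-1ℤ ℤ.* p) ℤ.* (ℤ.- u ℤ.* z) ≡ u ℤ.* (p ℤ.* z)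
    lemma = solve-∀
    -- The additional factor -1 from the larger rank absorbs the sign of the constant coefficient of
    -- `t- atomDifference`; what remains is cancelled against the positive `cR`.
    cQ≡ : -1ℤ ℤ.^ rank Q ℤ.* coeff (χ Q) 0 ≡ atomDifference ℤ.* cR
    cQ≡ = trans (cong₂ (λ n z → -1ℤ ℤ.^ n ℤ.* z) rank≡
        (trans (χ-linear-cofactor 0) (coeff-* (t- atomDifference) (χ R) 0)))
      (lemma (-1ℤ ℤ.^ rank R) atomDifference (coeff (χ R) 0))

module _ (P : RankedPoset) where
  open RankedPoset P

  private
    shift-ranks : ∀ {r} {x : Fin (suc (suc r)) → Carrier} →
                  (∀ i → rank (upper P (x i)) ℕ.+ toℕ i ≡ suc r) →
                  ∀ i → rank (upper P (x (fsuc i))) ℕ.+ toℕ i ≡ r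
    shift-ranks {x = x} ranks i = ℕₚ.suc-injective
      (trans (sym (ℕₚ.+-suc (rank (upper P (x (fsuc i)))) (toℕ i))) (ranks (fsuc i)))

    consecutive-ranks : ∀ {r} {x : Fin (suc (suc r)) → Carrier} →
      (∀ i → rank (upper P (x i)) ℕ.+ toℕ i ≡ suc r) →
      rank (upper P (x fzero)) ≡ suc (rank (upper P (x (fsuc fzero))))
    consecutive-ranks {x = x} ranks = trans (sym (ℕₚ.+-identityʳ (rank (upper P (x fzero)))))
      (trans (trans (ranks fzero) (sym (ranks (fsuc fzero)))) (ℕₚ.+-comm _ 1))

  -- The chain may start anywhere and the ranks enter only through those of the posets P≥x, so the
  -- tail `x ∘ fsuc` satisfies the same hypotheses. The sum form of the rank condition avoids
  -- truncated subtraction. At the end the rank is zero, and a monic polynomial of degree zero is 1.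
  χ-product : ∀ r (x : Fin (suc r) → Carrier) →
    (∀ i → rank (upper P (x i)) ℕ.+ toℕ i ≡ r) →
    (∀ i → χ (upper P (x (fsuc i))) ∣ₚ χ (upper P (x (inject₁ i)))) →
    χ (upper P (x fzero)) ≈ₚ ∏ₚ (tabulate (d P x))
  χ-product zero x ranks divides n = constant n
    where
    open Monic (subst (λ k → Monic k (χ (upper P (x fzero))))
      (trans (sym (ℕₚ.+-identityʳ (rank (upper P (x fzero))))) (ranks fzero)) (χ-monic (upper P (x fzero))))
    constant : ∀ n → coeff (χ (upper P (x fzero))) n ≡ coeff [ 1ℤ ] n
    constant zero    = leading
    constant (suc n) = above (ℕ.s≤s ℕ.z≤n)
  χ-product (suc r) x ranks divides n = trans
    (χ-linear-cofactor (upper P (x fzero)) (upper P (x (fsuc fzero))) (consecutive-ranks ranks) (divides fzero) n)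
    (*ₚ-cong {t- d P x fzero} {t- d P x fzero} {χ (upper P (x (fsuc fzero)))} {∏ₚ (tabulate (d P (x ∘ fsuc)))} (λ _ → refl)
      (χ-product r (x ∘ fsuc) (shift-ranks ranks) (divides ∘ fsuc)) n)

  d-positive : LocallyGeometric P → ∀ r (x : Fin (suc r) → Carrier) →
    (∀ i → rank (upper P (x i)) ℕ.+ toℕ i ≡ r) →
    (∀ i → χ (upper P (x (fsuc i))) ∣ₚ χ (upper P (x (inject₁ i)))) →
    All (0ℤ ℤ.<_) (tabulate (d P x))
  d-positive geo zero    x ranks divides = []
  d-positive geo (suc r) x ranks divides =
    atomDifference-positive (upper P (x fzero)) (upper P (x (fsuc fzero))) (consecutive-ranks ranks) (divides fzero)
      (locallyGeometric-upper P geo (x fzero)) (locallyGeometric-upper P geo (x (fsuc fzero)))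
    ∷ d-positive geo r (x ∘ fsuc) (shift-ranks ranks) (divides ∘ fsuc)

theorem3p11 : (P : RankedPoset) (r : ℕ) → rank P ≡ r → LocallyGeometric P →
    (Divisional P ⇔ (∃[ x ] IsDivisionalChain P {r} x))
    × ((x : Fin (suc r) → RankedPoset.Carrier P) → IsDivisionalChain P x →
       Factorable P × HasExponents P (tabulate (d P x)))
theorem3p11 P r rank≡r geo =
  mk⇔ (λ div → divisional⇒chain div r rank≡r) (λ (x , chain) → chain⇒divisional r P rank≡r geo x chain) ,
  λ x chain →
    let open IsDivisionalChain chain
        upper-ranks : ∀ i → rank (upper P (x i)) ℕ.+ toℕ i ≡ r
        upper-ranks = λ i → trans
          (cong (ℕ._+ toℕ i) (trans (rank-upper P (x i)) (cong₂ _∸_ rank≡r (ranks i))))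
          (ℕₚ.m∸n+n≡m (ℕₚ.≤-pred (Finₚ.toℕ<n i)))
        χ≈∏ : χ P ≈ₚ ∏ₚ (tabulate (d P x))
        χ≈∏ = λ n → trans (χ-isomorphism⁻¹ (upper-0̂≅ P starts) n) (χ-product P r x upper-ranks divides n)
    in roots-positive {χ P} χ≈∏ (d-positive P geo r x upper-ranks divides) ,
       -- As χ is monic, the scalar in front of the product is 1.
       1ℤ , (λ ()) , λ n → trans (χ≈∏ n)
         (sym (trans (coeff-· 1ℤ (∏ₚ (tabulate (d P x))) n) (ℤₚ.*-identityˡ _)))
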